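{- For every integer $m\ge1$ and every rational number $x$, \[ \gamma_{\mathcal{A}}^{\mathrm{K},m}(x)=\gamma_{\mathcal{A}}^{\mathrm{W}}+\delta_{ -1}(x+m)-1+(H_m-1)\,\ell_{\mathcal{A}}(x+m+1)+\sum_{j=0}^{m-1}(-1)^{m-j}\binom{m}{j}\frac{\ell_{\mathcal{A}}(x+j+1)}{m-j}\quad\text{in }\mathcal{A}. \]
   Context: $\mathcal{A}\coloneqq\big(\prod_{p\text{ prime}}\mathbb{Z}/p\mathbb{Z}\big)/\big(\bigoplus_{p\text{ prime}}\mathbb{Z}/p\mathbb{Z}\big)$, a $\mathbb{Q}$-algebra via the diagonal embedding of $\mathbb{Q}$ (for the finitely many primes dividing a denominator, the $p$-component is assigned arbitrarily). Gregory polynomials $G_n(x)\in\mathbb{Q}[x]$ are defined by $\frac{t(1+t)^x}{\log(1+t)}=\sum_{n\ge0}G_n(x)t^n$. $H_m=\sum_{j=1}^m1/j$, $(n)_{m+1}=n(n+1)\cdots(n+m)$. For $x\in\mathbb{Q}$, $\ell_{\mathcal{A}}(x)\coloneqq\big(\frac{x^p-x}{p}\bmod p\big)_p$ ($x$ times the Fermat quotient $\frac{x^{p-1}-1}{p}$; $\ell_{\mathcal{A}}(0)=0$). Define $\gamma_{\mathcal{A}}^{\mathrm{K},m}(x)\coloneqq\big(m!\sum_{n=1}^{p-m-1}\frac{(-1)^{n-1}G_n(x)}{(n)_{m+1}}\bmod p\big)_p+H_m-\ell_{\mathcal{A}}(x+m+1)$ and $\gamma_{\mathcal{A}}^{\mathrm{W}}\coloneqq\big(\frac{(p-1)!+1}{p}\bmod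 p\big)_p$. $\delta_{ -1}$ is the indicator function of $\{ -1\}$. -}

module Defs where

open import Data.Nat as ℕ using (ℕ; zero; suc; NonZero; _!)
open import Data.Nat.Divisibility using (_∣?_)
open import Data.Nat.Primality using (Prime)
open import Data.Nat.Combinatorics using (_C_)
open import Data.Integer as ℤ using (ℤ; +_)
open import Data.Integer.Divisibility as ℤD using ()
open import Data.Rational as ℚ using (ℚ; 0ℚ; 1ℚ; mkℚ)
open import Data.Rational.Properties as ℚP using ()
open import Data.List using (List; []; _∷_; upTo; map; foldr; zipWith)
open import Data.Product using (∃; ∃-syntax)
open import Relation.Nullary using (yes; no)
open import Relation.Nullary.Decidable using (does)
open import Data.Bool using (if_then_else_)

sumℚ : List ℚ → ℚ
sumℚ = foldr ℚ._+_ 0ℚ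

prodℚ : List ℚ → ℚ
prodℚ = foldr ℚ._*_ 1ℚ

Σℚ< : ℕ → (ℕ → ℚ) → ℚ
Σℚ< n f = sumℚ (map f (upTo n))

Πℚ< : ℕ → (ℕ → ℚ) → ℚ
Πℚ< n f = prodℚ (map f (upTo n))

ℕtoℚ : ℕ → ℚ
ℕtoℚ n = (+ n) ℚ./ 1

-- 1/n for a natural n (only ever applied to n ≥ 1; 1/0 := 0 is a junk value)
recipℕ : ℕ → ℚ
recipℕ zero    = 0ℚ
recipℕ (suc k) = (+ 1) ℚ./ suc k

signℚ : ℕ → ℚ
signℚ zero    = 1ℚ
signℚ (suc n) = ℚ.- signℚ n

powℚ : ℚ → ℕ → ℚ
powℚ x zero    = 1ℚ
powℚ x (suc n) = x ℚ.* powℚ x n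

Series : Set
Series = ℕ → ℚ

_·S_ : Series → Series → Series
(f ·S g) n = Σℚ< (suc n) (λ k → f k ℚ.* g (n ℕ.∸ k))

-- Reverse list [c_n, …, c_0] of the coefficients of the multiplicative
-- inverse of a series f with constant term 1:
-- c_0 = 1, c_n = - Σ_{k<n} f(n-k) c_k.
invRev : Series → ℕ → List ℚ
invRev f zero    = 1ℚ ∷ []
invRev f (suc n) =
  (ℚ.- sumℚ (zipWith (λ i c → f (suc i) ℚ.* c) (upTo (suc n)) rs)) ∷ rs
  where rs = invRev f n

headℚ : List ℚ → ℚ
headℚ []      = 0ℚ
headℚ (c ∷ _) = c

-- inverse series (meaningful for constant term 1)
invS : Series → Series
invS f n = headℚ (invRev f n)

-- log(1+t)/t = Σ_k (-1)^k t^k/(k+1)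
logOver : Series
logOver k = signℚ k ℚ.* recipℕ (suc k)

binomℚ : ℚ → ℕ → ℚ
binomℚ x k = Πℚ< k (λ i → x ℚ.- ℕtoℚ i) ℚ.* recipℕ (k !)

binomSeries : ℚ → Series
binomSeries x = binomℚ x

-- Gregory polynomials:  t(1+t)^x / log(1+t) = Σ_n G_n(x) t^n,
-- i.e. the product of (log(1+t)/t)^{-1} and (1+t)^x.
G : ℕ → ℚ → ℚ
G n x = (invS logOver ·S binomSeries x) n

H : ℕ → ℚ
H m = Σℚ< m (λ j → recipℕ (suc j))

rising : ℕ → ℕ → ℕ
rising n zero    = 1
rising n (suc k) = rising n k ℕ.* (n ℕ.+ k)

-- The ring 𝒜 = (Π_p ℤ/pℤ) / (⊕_p ℤ/pℤ)
-- An element is a family indexed by ℕ whose p-th entry (p prime) is an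
-- integer representing a residue class mod p; entries at non-primes are
-- irrelevant.  Two elements are equal iff they agree mod p for all but
-- finitely many primes p.

𝒜 : Set
𝒜 = ℕ → ℤ

infix 4 _≈𝒜_
_≈𝒜_ : 𝒜 → 𝒜 → Set
a ≈𝒜 b = ∃[ N ] ((p : ℕ) → Prime p → N ℕ.< p → (+ p) ℤD.∣ (a p ℤ.- b p))

infixl 6 _+𝒜_ _-𝒜_
infixl 7 _*𝒜_
_+𝒜_ : 𝒜 → 𝒜 → 𝒜
(a +𝒜 b) p = a p ℤ.+ b p

_-𝒜_ : 𝒜 → 𝒜 → 𝒜
(a -𝒜 b) p = a p ℤ.- b p

_*𝒜_ : 𝒜 → 𝒜 → 𝒜
(a *𝒜 b) p = a p ℤ.* b p

-- reduction of a rational modulo p:  n/d ↦ n·d^{p-2}  (≡ n·d⁻¹ mod p by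
-- Fermat) when p ∤ d, and an arbitrary value (0) when p ∣ d.
redℚ : ℕ → ℚ → ℤ
redℚ p q = if does (p ∣? ℚ.ℚ.denominatorℕ q) then + 0
           else ℚ.ℚ.numerator q ℤ.* (+ ℚ.ℚ.denominatorℕ q) ℤ.^ (p ℕ.∸ 2)

modFam : (ℕ → ℚ) → 𝒜
modFam f p = redℚ p (f p)

ι : ℚ → 𝒜
ι q = modFam (λ _ → q)

ℓ𝒜 : ℚ → 𝒜
ℓ𝒜 x = modFam (λ p → (powℚ x p ℚ.- x) ℚ.* recipℕ p)

γK : ℕ → ℚ → 𝒜
γK m x =
  modFam (λ p → ℕtoℚ (m !) ℚ.*
            Σℚ< (p ℕ.∸ m ℕ.∸ 1) (λ i →
              signℚ i ℚ.* G (suc i) x ℚ.* recipℕ (rising (suc i) (suc m))))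
  +𝒜 ι (H m) -𝒜 ℓ𝒜 (x ℚ.+ ℕtoℚ (suc m))

γW : 𝒜
γW = modFam (λ p → ℕtoℚ ((p ℕ.∸ 1) ! ℕ.+ 1) ℚ.* recipℕ p)

δ₋₁ : ℚ → ℚ
δ₋₁ y = if does (y ℚP.≟ ℚ.- 1ℚ) then 1ℚ else 0ℚ

0𝒜 : 𝒜
0𝒜 _ = + 0

Σ𝒜< : ℕ → (ℕ → 𝒜) → 𝒜
Σ𝒜< n f = foldr _+𝒜_ 0𝒜 (map f (upTo n))

{-# OPTIONS --safe #-}
-- Write F_x(t) = t(1+t)^x / log(1+t) = Σ G_n(x) t^n, q = p - 1, w = (q! + 1)/p and
-- ℓ(y) = (y^p - y)/p.  Put η = 1 + (1+t) d/dt and let φ n f be the constant term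
-- of ηⁿ f.  Applying ηⁿ⁺¹ to log(1+t) F_x = (1+t)^(x+1) - (1+t)^x gives
-- (n+1) φ n F_x = (x+2)^(n+1) - (x+1)^(n+1).  On the other hand, by Fermat,
-- φ q f ≡ f_0 + q! f_q mod p.  Hence G_q(x) + 1/p ≡ 1 - w - (ℓ(x+2) - ℓ(x+1)), and since
-- G_{n+1}(x+1) - G_{n+1}(x) = G_n(x), each G_n(x) with n < q is mod p, up to sign, a
-- higher difference of ℓ.
--
-- The weights m!/(n)_{m+1} are beta integrals B(n, m+1), so summation by parts
-- relates the sum for m+1 at x to the sum for m at x+1 up to boundary terms that
-- involve only such a G_n(x); the right-hand side obeys the same recursion.  The
-- case m = 1 is the coefficient of t^q in (log(1+t)/t) F_{x+1} = (1+t)^(x+1).  Finally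
-- binom(y, q) ≡ 1 - (y+1)^q is the indicator of y = -1 for large p.
module Submission where

open import Defs
open import Data.Integer as ℤ using (ℤ)
import Data.Integer.Divisibility as ℤD
import Data.Integer.Properties as ℤP
open import Data.List using (_∷_; map; upTo; applyUpTo; foldr; zipWith)
open import Data.List.Properties using (map-upTo; map-applyUpTo; map-id; zipWith-map)
open import Data.Nat as ℕ using (ℕ; zero; suc; _∸_; _≤_; _<_; s≤s; z≤n; NonZero; _!)
open import Data.Nat.Combinatorics using (_C_; nCk≡nC[n∸k]; nCn≡1; k>n⇒nCk≡0; nCk+nC[k+1]≡[n+1]C[k+1])
import Data.Nat.Coprimality as Coprimality
open import Data.Nat.Divisibility as ℕD using (_∣_; _∤_; _∣?_; divides)
open import Data.Nat.DivMod using (_%_; m≡m%n+[m/n]*n; m%n<n)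
open import Data.Nat.Primality using (Prime; euclidsLemma; prime⇒irreducible; prime⇒nonZero; prime⇒nonTrivial)
import Data.Nat.Properties as ℕP
open import Data.Product using (_,_; ∃)
open import Data.Rational using (ℚ; _+_; _-_; _*_; -_; _/_; 0ℚ; 1ℚ; toℚᵘ; ↥_; mkℚ; module ℚ)
open import Data.Rational.Properties as ℚP using (+-*-commutativeRing; _≟_)
open import Data.Rational.Unnormalised as ℚᵘ using (mkℚᵘ; *≡*)
import Data.Rational.Unnormalised.Properties as ℚᵘP
open import Data.Sum using (inj₁; inj₂; [_,_]′)
open import Function using (_∘_; id; _∋_)
open import Level using (0ℓ)
open import Relation.Binary using (Setoid)
open import Relation.Binary.PropositionalEquality
import Relation.Binary.Reasoning.Setoid as SetoidReasoning
open import Relation.Nullary using (yes; no; contradiction)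
open import Relation.Nullary.Decidable using (dec⇒maybe)
open import Tactic.RingSolver using (solve-∀)
open import Tactic.RingSolver.Core.AlmostCommutativeRing using (AlmostCommutativeRing; fromCommutativeRing)

-- The obstacle is that G_q(x) is not p-integral: its polar part is -1/p. This is why φ q F_x is
-- first computed exactly in ℚ and only then compared with its residue, why congruence mod p is a
-- relation on all rationals, and why the induction starts at m = 1: the passage from m = 0 to m = 1
-- would have G_q as its boundary term. For m at least 1 the range n < p - m keeps both (n)_{m+1}
-- and the denominators of G_n(x) prime to p.
--
-- The operator η is chosen for two properties. Each (1+t)^y is an eigenvector, with eigenvalue y+1,
-- so η turns binomial series into powers. And η commutes with multiplication by log(1+t) up to the
-- identity, so the logarithm in the denominator of F_x costs only a factor n+1. At n = q this
-- factor is p, and dividing p-th powers by p is what produces the Fermat quotients.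

ring : AlmostCommutativeRing 0ℓ 0ℓ
ring = fromCommutativeRing +-*-commutativeRing (λ x → dec⇒maybe (0ℚ ≟ x))

-- Rational numbers and finite sums

ℤtoℚ : ℤ → ℚ
ℤtoℚ z = z / 1

toℚᵘ-ℤtoℚ : ∀ z → toℚᵘ (ℤtoℚ z) ℚᵘ.≃ mkℚᵘ z 0
toℚᵘ-ℤtoℚ z = ℚP.toℚᵘ-fromℚᵘ (mkℚᵘ z 0)

ℤtoℚ-+ : ∀ a b → ℤtoℚ (a ℤ.+ b) ≡ ℤtoℚ a + ℤtoℚ b
ℤtoℚ-+ a b = ℚP.toℚᵘ-injective (begin
  toℚᵘ (ℤtoℚ (a ℤ.+ b))             ≈⟨ toℚᵘ-ℤtoℚ (a ℤ.+ b) ⟩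
  mkℚᵘ (a ℤ.+ b) 0                  ≡⟨ cong₂ (λ u v → mkℚᵘ (u ℤ.+ v) 0) (ℤP.*-identityʳ a) (ℤP.*-identityʳ b) ⟨
  mkℚᵘ a 0 ℚᵘ.+ mkℚᵘ b 0            ≈⟨ ℚᵘP.+-cong (toℚᵘ-ℤtoℚ a) (toℚᵘ-ℤtoℚ b) ⟨
  toℚᵘ (ℤtoℚ a) ℚᵘ.+ toℚᵘ (ℤtoℚ b)  ≈⟨ ℚP.toℚᵘ-homo-+ (ℤtoℚ a) (ℤtoℚ b) ⟨
  toℚᵘ (ℤtoℚ a + ℤtoℚ b)            ∎)
  where open ℚᵘP.≃-Reasoning

ℤtoℚ-* : ∀ a b → ℤtoℚ (a ℤ.* b) ≡ ℤtoℚ a * ℤtoℚ b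
ℤtoℚ-* a b = ℚP.toℚᵘ-injective (begin
  toℚᵘ (ℤtoℚ (a ℤ.* b))             ≈⟨ toℚᵘ-ℤtoℚ (a ℤ.* b) ⟩
  mkℚᵘ a 0 ℚᵘ.* mkℚᵘ b 0            ≈⟨ ℚᵘP.*-cong (toℚᵘ-ℤtoℚ a) (toℚᵘ-ℤtoℚ b) ⟨
  toℚᵘ (ℤtoℚ a) ℚᵘ.* toℚᵘ (ℤtoℚ b)  ≈⟨ ℚP.toℚᵘ-homo-* (ℤtoℚ a) (ℤtoℚ b) ⟨
  toℚᵘ (ℤtoℚ a * ℤtoℚ b)            ∎)
  where open ℚᵘP.≃-Reasoning

ℤtoℚ-neg : ∀ a → ℤtoℚ (ℤ.- a) ≡ - ℤtoℚ a
ℤtoℚ-neg a = ℚP.toℚᵘ-injective (begin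
  toℚᵘ (ℤtoℚ (ℤ.- a))  ≈⟨ toℚᵘ-ℤtoℚ (ℤ.- a) ⟩
  ℚᵘ.- mkℚᵘ a 0        ≈⟨ ℚᵘP.-‿cong (toℚᵘ-ℤtoℚ a) ⟨
  ℚᵘ.- toℚᵘ (ℤtoℚ a)   ≈⟨ ℚP.toℚᵘ-homo‿- (ℤtoℚ a) ⟨
  toℚᵘ (- ℤtoℚ a)      ∎)
  where open ℚᵘP.≃-Reasoning

ℤtoℚ-injective : ∀ a b → ℤtoℚ a ≡ ℤtoℚ b → a ≡ b
ℤtoℚ-injective a b eq with ℚᵘP.≃-trans (ℚᵘP.≃-sym (toℚᵘ-ℤtoℚ a)) (ℚᵘP.≃-trans (ℚP.toℚᵘ-cong eq) (toℚᵘ-ℤtoℚ b))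
... | *≡* e = trans (sym (ℤP.*-identityʳ a)) (trans e (ℤP.*-identityʳ b))

ℕtoℚ-+ : ∀ a b → ℕtoℚ (a ℕ.+ b) ≡ ℕtoℚ a + ℕtoℚ b
ℕtoℚ-+ a b = ℤtoℚ-+ (ℤ.+ a) (ℤ.+ b)

ℕtoℚ-* : ∀ a b → ℕtoℚ (a ℕ.* b) ≡ ℕtoℚ a * ℕtoℚ b
ℕtoℚ-* a b = trans (cong ℤtoℚ (ℤP.pos-* a b)) (ℤtoℚ-* (ℤ.+ a) (ℤ.+ b))

ℕtoℚ-suc : ∀ n → ℕtoℚ (suc n) ≡ 1ℚ + ℕtoℚ n
ℕtoℚ-suc n = ℕtoℚ-+ 1 n

*-recipℕ-suc : ∀ n → ℕtoℚ (suc n) * recipℕ (suc n) ≡ 1ℚ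
*-recipℕ-suc n = ℚP.toℚᵘ-injective (begin
  toℚᵘ (ℕtoℚ (suc n) * recipℕ (suc n))             ≈⟨ ℚP.toℚᵘ-homo-* (ℕtoℚ (suc n)) (recipℕ (suc n)) ⟩
  toℚᵘ (ℕtoℚ (suc n)) ℚᵘ.* toℚᵘ (recipℕ (suc n))   ≈⟨ ℚᵘP.*-cong (toℚᵘ-ℤtoℚ (ℤ.+ suc n)) (ℚP.toℚᵘ-fromℚᵘ (mkℚᵘ (ℤ.+ 1) n)) ⟩
  mkℚᵘ (ℤ.+ suc n) 0 ℚᵘ.* mkℚᵘ (ℤ.+ 1) n               ≈⟨ *≡* (cong ℤ.+_ (trans (ℕP.*-identityʳ _) (trans (ℕP.*-identityʳ (suc n)) (sym (trans (ℕP.*-identityˡ _) (ℕP.*-identityˡ _)))))) ⟩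
  toℚᵘ 1ℚ                                          ∎)
  where open ℚᵘP.≃-Reasoning

*-recipℕ : ∀ n .{{_ : NonZero n}} → ℕtoℚ n * recipℕ n ≡ 1ℚ
*-recipℕ (suc n) = *-recipℕ-suc n

recip-* : ∀ n .{{_ : NonZero n}} a → recipℕ n * (ℕtoℚ n * a) ≡ a
recip-* n a = trans (((∀ r m a → r * (m * a) ≡ (m * r) * a) ∋ solve-∀ ring) (recipℕ n) (ℕtoℚ n) a)
                    (trans (cong (_* a) (*-recipℕ n)) (ℚP.*-identityˡ a))

ℕtoℚ-cancelˡ : ∀ n .{{_ : NonZero n}} {a b} → ℕtoℚ n * a ≡ ℕtoℚ n * b → a ≡ b
ℕtoℚ-cancelˡ n {a} {b} eq = trans (sym (recip-* n a)) (trans (cong (recipℕ n *_) eq) (recip-* n b))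

recipℕ-* : ∀ m n .{{_ : NonZero m}} .{{_ : NonZero n}} → recipℕ (m ℕ.* n) ≡ recipℕ m * recipℕ n
recipℕ-* m n = ℕtoℚ-cancelˡ (m ℕ.* n) {{ℕP.m*n≢0 m n}} (begin
  ℕtoℚ (m ℕ.* n) * recipℕ (m ℕ.* n)            ≡⟨ *-recipℕ (m ℕ.* n) {{ℕP.m*n≢0 m n}} ⟩
  1ℚ                                           ≡⟨ cong₂ _*_ (*-recipℕ m) (*-recipℕ n) ⟨
  (ℕtoℚ m * recipℕ m) * (ℕtoℚ n * recipℕ n)    ≡⟨ ((∀ a b c d → (a * b) * (c * d) ≡ (a * c) * (b * d)) ∋ solve-∀ ring) (ℕtoℚ m) (recipℕ m) (ℕtoℚ n) (recipℕ n) ⟩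
  (ℕtoℚ m * ℕtoℚ n) * (recipℕ m * recipℕ n)    ≡⟨ cong (_* (recipℕ m * recipℕ n)) (ℕtoℚ-* m n) ⟨
  ℕtoℚ (m ℕ.* n) * (recipℕ m * recipℕ n)       ∎)
  where open ≡-Reasoning

Σ-first : ∀ n f → Σℚ< (suc n) f ≡ f 0 + Σℚ< n (f ∘ suc)
Σ-first n f = cong (λ l → f 0 + sumℚ l) (trans (map-applyUpTo suc f n) (sym (map-upTo (f ∘ suc) n)))

Σ-last : ∀ n f → Σℚ< (suc n) f ≡ Σℚ< n f + f n
Σ-last zero f = ℚP.+-comm (f 0) 0ℚ
Σ-last (suc n) f = begin
  Σℚ< (suc (suc n)) f                        ≡⟨ Σ-first (suc n) f ⟩
  f 0 + Σℚ< (suc n) (f ∘ suc)                ≡⟨ cong (f 0 +_) (Σ-last n (f ∘ suc)) ⟩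
  f 0 + (Σℚ< n (f ∘ suc) + f (suc n))        ≡⟨ ℚP.+-assoc (f 0) _ _ ⟨
  f 0 + Σℚ< n (f ∘ suc) + f (suc n)          ≡⟨ cong (_+ f (suc n)) (Σ-first n f) ⟨
  Σℚ< (suc n) f + f (suc n)                  ∎
  where open ≡-Reasoning

Σ-induction : (P : ℚ → Set) → P 0ℚ → (∀ {a b} → P a → P b → P (a + b)) →
              ∀ n f → (∀ i → i < n → P (f i)) → P (Σℚ< n f)
Σ-induction P P0 P+ zero    f h = P0
Σ-induction P P0 P+ (suc n) f h = subst P (sym (Σ-last n f))
  (P+ (Σ-induction P P0 P+ n f (λ i i<n → h i (ℕP.m<n⇒m<1+n i<n))) (h n (ℕP.n<1+n n)))

Σ-cong : ∀ n {f g} → (∀ i → i < n → f i ≡ g i) → Σℚ< n f ≡ Σℚ< n g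
Σ-cong zero    h = refl
Σ-cong (suc n) {f} {g} h = trans (Σ-last n f) (trans
  (cong₂ _+_ (Σ-cong n (λ i i<n → h i (ℕP.m<n⇒m<1+n i<n))) (h n (ℕP.n<1+n n)))
  (sym (Σ-last n g)))

Σ-+ : ∀ n (f g : ℕ → ℚ) → Σℚ< n (λ i → f i + g i) ≡ Σℚ< n f + Σℚ< n g
Σ-+ zero    f g = refl
Σ-+ (suc n) f g = begin
  Σℚ< (suc n) (λ i → f i + g i)                  ≡⟨ Σ-last n _ ⟩
  Σℚ< n (λ i → f i + g i) + (f n + g n)          ≡⟨ cong (_+ (f n + g n)) (Σ-+ n f g) ⟩
  (Σℚ< n f + Σℚ< n g) + (f n + g n)              ≡⟨ ((∀ a b c d → (a + b) + (c + d) ≡ (a + c) + (b + d)) ∋ solve-∀ ring) (Σℚ< n f) (Σℚ< n g) (f n) (g n) ⟩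
  (Σℚ< n f + f n) + (Σℚ< n g + g n)              ≡⟨ cong₂ _+_ (Σ-last n f) (Σ-last n g) ⟨
  Σℚ< (suc n) f + Σℚ< (suc n) g                  ∎
  where open ≡-Reasoning

Σ-*ˡ : ∀ n c (f : ℕ → ℚ) → Σℚ< n (λ i → c * f i) ≡ c * Σℚ< n f
Σ-*ˡ zero    c f = sym (ℚP.*-zeroʳ c)
Σ-*ˡ (suc n) c f = begin
  Σℚ< (suc n) (λ i → c * f i)         ≡⟨ Σ-last n _ ⟩
  Σℚ< n (λ i → c * f i) + c * f n     ≡⟨ cong (_+ c * f n) (Σ-*ˡ n c f) ⟩
  c * Σℚ< n f + c * f n               ≡⟨ ℚP.*-distribˡ-+ c _ _ ⟨
  c * (Σℚ< n f + f n)                 ≡⟨ cong (c *_) (Σ-last n f) ⟨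
  c * Σℚ< (suc n) f                   ∎
  where open ≡-Reasoning

Σ-0 : ∀ n {f} → (∀ i → i < n → f i ≡ 0ℚ) → Σℚ< n f ≡ 0ℚ
Σ-0 n {f} = Σ-induction (_≡ 0ℚ) refl (cong₂ _+_) n f

Σ-reverse : ∀ n f → Σℚ< n f ≡ Σℚ< n (λ i → f (n ∸ suc i))
Σ-reverse zero    f = refl
Σ-reverse (suc n) f = begin
  Σℚ< (suc n) f                              ≡⟨ Σ-last n f ⟩
  Σℚ< n f + f n                              ≡⟨ ℚP.+-comm _ (f n) ⟩
  f n + Σℚ< n f                              ≡⟨ cong (f n +_) (Σ-reverse n f) ⟩
  f n + Σℚ< n (λ i → f (n ∸ suc i))          ≡⟨ Σ-first n (λ i → f (n ∸ i)) ⟨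
  Σℚ< (suc n) (λ i → f (suc n ∸ suc i))      ∎
  where open ≡-Reasoning

-- Abel summation with a plus sign, because Pascal's rule, `G-suc` and `η` all produce sums, not
-- differences, of neighbouring terms.
summation-by-parts : ∀ n (c g : ℕ → ℚ) → Σℚ< (suc n) (λ i → c i * (g (suc i) + g i)) ≡
                     c 0 * g 0 + Σℚ< n (λ i → (c i + c (suc i)) * g (suc i)) + c n * g (suc n)
summation-by-parts zero c g =
  ((∀ a b c → a * (b + c) + 0ℚ ≡ a * c + 0ℚ + a * b) ∋ solve-∀ ring) (c 0) (g 1) (g 0)
summation-by-parts (suc n) c g = begin
  Σℚ< (suc (suc n)) (λ i → c i * (g (suc i) + g i))
    ≡⟨ Σ-last (suc n) (λ i → c i * (g (suc i) + g i)) ⟩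
  Σℚ< (suc n) (λ i → c i * (g (suc i) + g i)) + c₁ * (g₂ + g₁)
    ≡⟨ cong (_+ c₁ * (g₂ + g₁)) (summation-by-parts n c g) ⟩
  (c 0 * g 0 + Σℚ< n h + c n * g₁) + c₁ * (g₂ + g₁)
    ≡⟨ ((∀ a s c₀ c₁ g₁ g₂ → a + s + c₀ * g₁ + c₁ * (g₂ + g₁) ≡ a + (s + (c₀ + c₁) * g₁) + c₁ * g₂) ∋ solve-∀ ring) (c 0 * g 0) (Σℚ< n h) (c n) c₁ g₁ g₂ ⟩
  c 0 * g 0 + (Σℚ< n h + h n) + c₁ * g₂
    ≡⟨ cong (λ s → c 0 * g 0 + s + c₁ * g₂) (Σ-last n h) ⟨
  c 0 * g 0 + Σℚ< (suc n) h + c₁ * g₂ ∎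
  where
  open ≡-Reasoning
  c₁ = c (suc n)
  g₁ = g (suc n)
  g₂ = g (suc (suc n))
  h = λ i → (c i + c (suc i)) * g (suc i)

-- Formal power series

infix 4 _≗S_
_≗S_ : Series → Series → Set
f ≗S g = ∀ n → f n ≡ g n

tail shift : Series → Series
tail f n = f (suc n)
shift f zero    = 0ℚ
shift f (suc n) = f n

infixl 6 _+S_
_+S_ : Series → Series → Series
(f +S g) n = f n + g n

1S : Series
1S zero    = 1ℚ
1S (suc n) = 0ℚ

·S-zero : ∀ f g → (f ·S g) 0 ≡ f 0 * g 0
·S-zero f g = ℚP.+-identityʳ (f 0 * g 0)

·S-suc : ∀ f g n → (f ·S g) (suc n) ≡ f 0 * g (suc n) + (tail f ·S g) n
·S-suc f g n = Σ-first (suc n) (λ k → f k * g (suc n ∸ k))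

·S-cong : ∀ {f f′ g g′} → f ≗S f′ → g ≗S g′ → f ·S g ≗S f′ ·S g′
·S-cong f≗ g≗ n = Σ-cong (suc n) (λ i _ → cong₂ _*_ (f≗ i) (g≗ (n ∸ i)))

·S-distribʳ-+S : ∀ f g h → (f +S g) ·S h ≗S f ·S h +S g ·S h
·S-distribʳ-+S f g h n = trans
  (Σ-cong (suc n) (λ i _ → ℚP.*-distribʳ-+ (h (n ∸ i)) (f i) (g i)))
  (Σ-+ (suc n) (λ i → f i * h (n ∸ i)) (λ i → g i * h (n ∸ i)))

·S-distribˡ-+S : ∀ f g h → f ·S (g +S h) ≗S f ·S g +S f ·S h
·S-distribˡ-+S f g h n = trans
  (Σ-cong (suc n) (λ i _ → ℚP.*-distribˡ-+ (f i) (g (n ∸ i)) (h (n ∸ i))))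
  (Σ-+ (suc n) (λ i → f i * g (n ∸ i)) (λ i → f i * h (n ∸ i)))

·S-scaleˡ : ∀ c f g → (λ k → c * f k) ·S g ≗S (λ k → c * (f ·S g) k)
·S-scaleˡ c f g n = trans
  (Σ-cong (suc n) (λ i _ → ℚP.*-assoc c (f i) (g (n ∸ i))))
  (Σ-*ˡ (suc n) c (λ i → f i * g (n ∸ i)))

-- Induction on the degree through `·S-suc`, which peels off the constant term of the left factor;
-- this replaces the reindexing of a double sum.
·S-assoc : ∀ f g h → (f ·S g) ·S h ≗S f ·S (g ·S h)
·S-assoc f g h zero = begin
  ((f ·S g) ·S h) 0    ≡⟨ ·S-zero (f ·S g) h ⟩
  (f ·S g) 0 * h 0     ≡⟨ cong (_* h 0) (·S-zero f g) ⟩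
  f 0 * g 0 * h 0      ≡⟨ ℚP.*-assoc (f 0) (g 0) (h 0) ⟩
  f 0 * (g 0 * h 0)    ≡⟨ cong (f 0 *_) (·S-zero g h) ⟨
  f 0 * (g ·S h) 0     ≡⟨ ·S-zero f (g ·S h) ⟨
  (f ·S (g ·S h)) 0    ∎
  where open ≡-Reasoning
·S-assoc f g h (suc n) = begin
  ((f ·S g) ·S h) (suc n)
    ≡⟨ ·S-suc (f ·S g) h n ⟩
  (f ·S g) 0 * h₁ + (tail (f ·S g) ·S h) n
    ≡⟨ cong₂ _+_ (cong (_* h₁) (·S-zero f g)) (begin
      (tail (f ·S g) ·S h) n
        ≡⟨ ·S-cong {g = h} (·S-suc f g) (λ _ → refl) n ⟩
      (((λ k → f 0 * tail g k) +S (tail f ·S g)) ·S h) n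
        ≡⟨ ·S-distribʳ-+S (λ k → f 0 * tail g k) (tail f ·S g) h n ⟩
      ((λ k → f 0 * tail g k) ·S h) n + ((tail f ·S g) ·S h) n
        ≡⟨ cong₂ _+_ (·S-scaleˡ (f 0) (tail g) h n) (·S-assoc (tail f) g h n) ⟩
      f 0 * (tail g ·S h) n + (tail f ·S (g ·S h)) n ∎) ⟩
  f 0 * g 0 * h₁ + (f 0 * (tail g ·S h) n + (tail f ·S (g ·S h)) n)
    ≡⟨ ((∀ a b c d e → a * b * c + (a * d + e) ≡ a * (b * c + d) + e) ∋ solve-∀ ring) (f 0) (g 0) h₁ ((tail g ·S h) n) ((tail f ·S (g ·S h)) n) ⟩
  f 0 * (g 0 * h₁ + (tail g ·S h) n) + (tail f ·S (g ·S h)) n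
    ≡⟨ cong (λ s → f 0 * s + (tail f ·S (g ·S h)) n) (·S-suc g h n) ⟨
  f 0 * (g ·S h) (suc n) + (tail f ·S (g ·S h)) n
    ≡⟨ ·S-suc f (g ·S h) n ⟨
  (f ·S (g ·S h)) (suc n) ∎
  where
  open ≡-Reasoning
  h₁ = h (suc n)

·S-identityˡ : ∀ f → 1S ·S f ≗S f
·S-identityˡ f zero    = trans (·S-zero 1S f) (ℚP.*-identityˡ (f 0))
·S-identityˡ f (suc n) = begin
  (1S ·S f) (suc n)                             ≡⟨ ·S-suc 1S f n ⟩
  1ℚ * f (suc n) + (tail 1S ·S f) n             ≡⟨ cong₂ _+_ (ℚP.*-identityˡ (f (suc n))) (Σ-0 (suc n) (λ i _ → ℚP.*-zeroˡ (f (n ∸ i)))) ⟩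
  f (suc n) + 0ℚ                                ≡⟨ ℚP.+-identityʳ _ ⟩
  f (suc n)                                     ∎
  where open ≡-Reasoning

·S-shiftˡ : ∀ f g n → (shift f ·S g) (suc n) ≡ (f ·S g) n
·S-shiftˡ f g n = trans (·S-suc (shift f) g n)
  (((∀ a b → 0ℚ * a + b ≡ b) ∋ solve-∀ ring) (g (suc n)) ((f ·S g) n))

·S-tailʳ : ∀ f g n → g 0 ≡ 0ℚ → (f ·S g) (suc n) ≡ (f ·S tail g) n
·S-tailʳ f g zero g₀≡0 = begin
  (f ·S g) 1                          ≡⟨ ·S-suc f g 0 ⟩
  f 0 * g 1 + (tail f ·S g) 0         ≡⟨ cong (f 0 * g 1 +_) (trans (·S-zero (tail f) g) (cong (f 1 *_) g₀≡0)) ⟩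
  f 0 * g 1 + f 1 * 0ℚ                ≡⟨ ((∀ a b → a + b * 0ℚ ≡ a) ∋ solve-∀ ring) (f 0 * g 1) (f 1) ⟩
  f 0 * g 1                           ≡⟨ ·S-zero f (tail g) ⟨
  (f ·S tail g) 0                     ∎
  where open ≡-Reasoning
·S-tailʳ f g (suc n) g₀≡0 = begin
  (f ·S g) (suc (suc n))                          ≡⟨ ·S-suc f g (suc n) ⟩
  f 0 * g (suc (suc n)) + (tail f ·S g) (suc n)   ≡⟨ cong (f 0 * g (suc (suc n)) +_) (·S-tailʳ (tail f) g n g₀≡0) ⟩
  f 0 * g (suc (suc n)) + (tail f ·S tail g) n    ≡⟨ ·S-suc f (tail g) n ⟨
  (f ·S tail g) (suc n)                           ∎
  where open ≡-Reasoning

-- `invRev` lists the coefficients from degree n downwards, so pairing the i-th entry with h_i is a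
-- Cauchy product. The series h is independent of f because the induction replaces h by its tail
-- while f stays fixed.
zipWith-invRev : ∀ f h n →
  sumℚ (zipWith (λ i c → h i * c) (upTo (suc n)) (invRev f n)) ≡ (h ·S invS f) n
zipWith-invRev f h zero    = refl
zipWith-invRev f h (suc n) = begin
  h 0 * c₁ + sumℚ (zipWith (λ i c → h i * c) (applyUpTo suc (suc n)) (invRev f n))
    ≡⟨ cong (λ l → h 0 * c₁ + sumℚ l) (begin
      zipWith (λ i c → h i * c) (applyUpTo suc (suc n)) (invRev f n)
        ≡⟨ cong₂ (zipWith (λ i c → h i * c)) (map-upTo suc (suc n)) (map-id (invRev f n)) ⟨
      zipWith (λ i c → h i * c) (map suc (upTo (suc n))) (map id (invRev f n))
        ≡⟨ zipWith-map (λ i c → h i * c) suc id (upTo (suc n)) (invRev f n) ⟩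
      zipWith (λ i c → tail h i * c) (upTo (suc n)) (invRev f n) ∎) ⟩
  h 0 * c₁ + sumℚ (zipWith (λ i c → tail h i * c) (upTo (suc n)) (invRev f n))
    ≡⟨ cong (h 0 * c₁ +_) (zipWith-invRev f (tail h) n) ⟩
  h 0 * c₁ + (tail h ·S invS f) n
    ≡⟨ ·S-suc h (invS f) n ⟨
  (h ·S invS f) (suc n) ∎
  where
  open ≡-Reasoning
  c₁ = invS f (suc n)

invS-inverseʳ : ∀ f → f 0 ≡ 1ℚ → f ·S invS f ≗S 1S
invS-inverseʳ f f₀≡1 zero    = trans (·S-zero f (invS f)) (cong (_* 1ℚ) f₀≡1)
invS-inverseʳ f f₀≡1 (suc n) = begin
  (f ·S invS f) (suc n)                             ≡⟨ ·S-suc f (invS f) n ⟩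
  f 0 * invS f (suc n) + (tail f ·S invS f) n       ≡⟨ cong₂ (λ a b → a * (- b) + (tail f ·S invS f) n) f₀≡1 (zipWith-invRev f (tail f) n) ⟩
  1ℚ * (- (tail f ·S invS f) n) + (tail f ·S invS f) n   ≡⟨ ((∀ a → 1ℚ * (- a) + a ≡ 0ℚ) ∋ solve-∀ ring) ((tail f ·S invS f) n) ⟩
  0ℚ                                                ∎
  where open ≡-Reasoning

-- Binomial coefficients and Gregory polynomials

Π-last : ∀ n f → Πℚ< (suc n) f ≡ Πℚ< n f * f n
Π-last zero f = ℚP.*-comm (f 0) 1ℚ
Π-last (suc n) f = begin
  f 0 * prodℚ (map f (applyUpTo suc (suc n)))   ≡⟨ cong (λ l → f 0 * prodℚ l) (map-suc (suc n)) ⟩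
  f 0 * Πℚ< (suc n) (f ∘ suc)                   ≡⟨ cong (f 0 *_) (Π-last n (f ∘ suc)) ⟩
  f 0 * (Πℚ< n (f ∘ suc) * f (suc n))           ≡⟨ ℚP.*-assoc (f 0) (Πℚ< n (f ∘ suc)) (f (suc n)) ⟨
  f 0 * Πℚ< n (f ∘ suc) * f (suc n)             ≡⟨ cong (λ l → f 0 * prodℚ l * f (suc n)) (map-suc n) ⟨
  Πℚ< (suc n) f * f (suc n)                     ∎
  where
  open ≡-Reasoning
  map-suc : ∀ m → map f (applyUpTo suc m) ≡ map (f ∘ suc) (upTo m)
  map-suc m = trans (map-applyUpTo suc f m) (sym (map-upTo (f ∘ suc) m))

binomℚ-suc : ∀ x k → ℕtoℚ (suc k) * binomℚ x (suc k) ≡ (x - ℕtoℚ k) * binomℚ x k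
binomℚ-suc x k = begin
  ℕtoℚ (suc k) * (Πℚ< (suc k) f * recipℕ (suc k !))
    ≡⟨ cong₂ (λ a b → ℕtoℚ (suc k) * (a * b)) (Π-last k f) (recipℕ-* (suc k) (k !) {{_}} {{k ℕP.!≢0}}) ⟩
  ℕtoℚ (suc k) * (Πℚ< k f * (x - ℕtoℚ k) * (recipℕ (suc k) * recipℕ (k !)))
    ≡⟨ ((∀ s r a b c → s * (a * b * (r * c)) ≡ (s * r) * (b * (a * c))) ∋ solve-∀ ring)
       (ℕtoℚ (suc k)) (recipℕ (suc k)) (Πℚ< k f) (x - ℕtoℚ k) (recipℕ (k !)) ⟩
  (ℕtoℚ (suc k) * recipℕ (suc k)) * ((x - ℕtoℚ k) * binomℚ x k)
    ≡⟨ cong (_* ((x - ℕtoℚ k) * binomℚ x k)) (*-recipℕ (suc k)) ⟩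
  1ℚ * ((x - ℕtoℚ k) * binomℚ x k)
    ≡⟨ ℚP.*-identityˡ _ ⟩
  (x - ℕtoℚ k) * binomℚ x k ∎
  where
  open ≡-Reasoning
  f = λ i → x - ℕtoℚ i

binomℚ-pascal : ∀ x k → binomℚ (x + 1ℚ) (suc k) ≡ binomℚ x (suc k) + binomℚ x k
binomℚ-pascal x k = ℕtoℚ-cancelˡ (suc k) (begin
  ℕtoℚ (suc k) * binomℚ (x + 1ℚ) (suc k)                    ≡⟨ binomℚ-suc (x + 1ℚ) k ⟩
  (x + 1ℚ - ℕtoℚ k) * binomℚ (x + 1ℚ) k                     ≡⟨ step k ⟩
  (x - ℕtoℚ k) * binomℚ x k + (1ℚ + ℕtoℚ k) * binomℚ x k    ≡⟨ cong₂ (λ a s → a + s * binomℚ x k) (sym (binomℚ-suc x k)) (sym (ℕtoℚ-suc k)) ⟩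
  ℕtoℚ (suc k) * binomℚ x (suc k) + ℕtoℚ (suc k) * binomℚ x k  ≡⟨ ℚP.*-distribˡ-+ (ℕtoℚ (suc k)) (binomℚ x (suc k)) (binomℚ x k) ⟨
  ℕtoℚ (suc k) * (binomℚ x (suc k) + binomℚ x k)            ∎)
  where
  open ≡-Reasoning
  -- For k = j+1, Pascal's rule in degree j expands the left side, and `binomℚ-suc` trades (x-j)
  -- binom(x,j) for (j+1) binom(x,j+1).
  step : ∀ k → (x + 1ℚ - ℕtoℚ k) * binomℚ (x + 1ℚ) k ≡ (x - ℕtoℚ k) * binomℚ x k + (1ℚ + ℕtoℚ k) * binomℚ x k
  step zero    = ((∀ x b → (x + 1ℚ - 0ℚ) * b ≡ (x - 0ℚ) * b + (1ℚ + 0ℚ) * b) ∋ solve-∀ ring) x 1ℚ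
  step (suc j) = begin
    (x + 1ℚ - ℕtoℚ (suc j)) * binomℚ (x + 1ℚ) (suc j)
      ≡⟨ cong ((x + 1ℚ - ℕtoℚ (suc j)) *_) (binomℚ-pascal x j) ⟩
    (x + 1ℚ - ℕtoℚ (suc j)) * (b₁ + b₀)
      ≡⟨ cong (λ s → (x + 1ℚ - s) * (b₁ + b₀)) (ℕtoℚ-suc j) ⟩
    (x + 1ℚ - (1ℚ + ℕtoℚ j)) * (b₁ + b₀)
      ≡⟨ ((∀ x j b₁ b₀ → (x + 1ℚ - (1ℚ + j)) * (b₁ + b₀) ≡ (x - j) * b₁ + (x - j) * b₀) ∋ solve-∀ ring) x (ℕtoℚ j) b₁ b₀ ⟩
    (x - ℕtoℚ j) * b₁ + (x - ℕtoℚ j) * b₀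
      ≡⟨ cong ((x - ℕtoℚ j) * b₁ +_) (trans (sym (binomℚ-suc x j)) (cong (_* b₁) (ℕtoℚ-suc j))) ⟩
    (x - ℕtoℚ j) * b₁ + (1ℚ + ℕtoℚ j) * b₁
      ≡⟨ ((∀ x j b₁ → (x - j) * b₁ + (1ℚ + j) * b₁ ≡ (x - (1ℚ + j)) * b₁ + (1ℚ + (1ℚ + j)) * b₁) ∋ solve-∀ ring) x (ℕtoℚ j) b₁ ⟩
    (x - (1ℚ + ℕtoℚ j)) * b₁ + (1ℚ + (1ℚ + ℕtoℚ j)) * b₁
      ≡⟨ cong (λ s → (x - s) * b₁ + (1ℚ + s) * b₁) (ℕtoℚ-suc j) ⟨
    (x - ℕtoℚ (suc j)) * b₁ + (1ℚ + ℕtoℚ (suc j)) * b₁ ∎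
    where
    b₁ = binomℚ x (suc j)
    b₀ = binomℚ x j

binomℚ-ℕ-suc : ∀ j k → binomℚ (ℕtoℚ (suc j)) (suc k) ≡ binomℚ (ℕtoℚ j) (suc k) + binomℚ (ℕtoℚ j) k
binomℚ-ℕ-suc j k = trans (cong (λ y → binomℚ y (suc k)) (trans (ℕtoℚ-suc j) (ℚP.+-comm 1ℚ (ℕtoℚ j)))) (binomℚ-pascal (ℕtoℚ j) k)

binomℚ-ℕ-< : ∀ {j k} → j < k → binomℚ (ℕtoℚ j) k ≡ 0ℚ
binomℚ-ℕ-< {zero}  {suc zero}    _ = refl
binomℚ-ℕ-< {zero}  {suc (suc k)} _ = ℕtoℚ-cancelˡ (suc (suc k)) (begin
  ℕtoℚ (suc (suc k)) * binomℚ 0ℚ (suc (suc k))   ≡⟨ binomℚ-suc 0ℚ (suc k) ⟩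
  (0ℚ - ℕtoℚ (suc k)) * binomℚ 0ℚ (suc k)        ≡⟨ cong ((0ℚ - ℕtoℚ (suc k)) *_) (binomℚ-ℕ-< {0} {suc k} (s≤s z≤n)) ⟩
  (0ℚ - ℕtoℚ (suc k)) * 0ℚ                       ≡⟨ ((∀ a b → a * 0ℚ ≡ b * 0ℚ) ∋ solve-∀ ring) (0ℚ - ℕtoℚ (suc k)) (ℕtoℚ (suc (suc k))) ⟩
  ℕtoℚ (suc (suc k)) * 0ℚ                        ∎)
  where open ≡-Reasoning
binomℚ-ℕ-< {suc j} {suc k} (s≤s j<k) = trans (binomℚ-ℕ-suc j k)
  (cong₂ _+_ (binomℚ-ℕ-< (ℕP.m<n⇒m<1+n j<k)) (binomℚ-ℕ-< j<k))

binomℚ-ℕ-≡ : ∀ j → binomℚ (ℕtoℚ j) j ≡ 1ℚ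
binomℚ-ℕ-≡ zero    = refl
binomℚ-ℕ-≡ (suc j) = trans (binomℚ-ℕ-suc j j) (cong₂ _+_ (binomℚ-ℕ-< (ℕP.n<1+n j)) (binomℚ-ℕ-≡ j))

-- Both sides equal (k+1) binom(x+1, k+1), once by the ratio of consecutive coefficients and once by
-- Pascal's rule.
binomℚ-absorption : ∀ x k → (x + 1ℚ - ℕtoℚ k) * binomℚ (x + 1ℚ) k ≡ (x + 1ℚ) * binomℚ x k
binomℚ-absorption x k = begin
  (x + 1ℚ - ℕtoℚ k) * binomℚ (x + 1ℚ) k                           ≡⟨ binomℚ-suc (x + 1ℚ) k ⟨
  ℕtoℚ (suc k) * binomℚ (x + 1ℚ) (suc k)                          ≡⟨ cong (ℕtoℚ (suc k) *_) (binomℚ-pascal x k) ⟩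
  ℕtoℚ (suc k) * (binomℚ x (suc k) + binomℚ x k)                  ≡⟨ ℚP.*-distribˡ-+ (ℕtoℚ (suc k)) (binomℚ x (suc k)) (binomℚ x k) ⟩
  ℕtoℚ (suc k) * binomℚ x (suc k) + ℕtoℚ (suc k) * binomℚ x k     ≡⟨ cong₂ (λ a s → a + s * binomℚ x k) (binomℚ-suc x k) (ℕtoℚ-suc k) ⟩
  (x - ℕtoℚ k) * binomℚ x k + (1ℚ + ℕtoℚ k) * binomℚ x k          ≡⟨ ((∀ x k b → (x - k) * b + (1ℚ + k) * b ≡ (x + 1ℚ) * b) ∋ solve-∀ ring) x (ℕtoℚ k) (binomℚ x k) ⟩
  (x + 1ℚ) * binomℚ x k                                           ∎
  where open ≡-Reasoning

C≡binomℚ : ∀ n k → ℕtoℚ (n C k) ≡ binomℚ (ℕtoℚ n) k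
C≡binomℚ n       zero    = cong ℕtoℚ (trans (nCk≡nC[n∸k] {0} {n} z≤n) (nCn≡1 n))
C≡binomℚ zero    (suc k) = trans (cong ℕtoℚ (k>n⇒nCk≡0 {0} {suc k} (s≤s z≤n))) (sym (binomℚ-ℕ-< {0} {suc k} (s≤s z≤n)))
C≡binomℚ (suc n) (suc k) = begin
  ℕtoℚ (suc n C suc k)                                ≡⟨ cong ℕtoℚ (nCk+nC[k+1]≡[n+1]C[k+1] n k) ⟨
  ℕtoℚ (n C k ℕ.+ n C suc k)                          ≡⟨ ℕtoℚ-+ (n C k) (n C suc k) ⟩
  ℕtoℚ (n C k) + ℕtoℚ (n C suc k)                     ≡⟨ cong₂ _+_ (C≡binomℚ n k) (C≡binomℚ n (suc k)) ⟩
  binomℚ (ℕtoℚ n) k + binomℚ (ℕtoℚ n) (suc k)         ≡⟨ ℚP.+-comm (binomℚ (ℕtoℚ n) k) (binomℚ (ℕtoℚ n) (suc k)) ⟩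
  binomℚ (ℕtoℚ n) (suc k) + binomℚ (ℕtoℚ n) k         ≡⟨ binomℚ-ℕ-suc n k ⟨
  binomℚ (ℕtoℚ (suc n)) (suc k)                       ∎
  where open ≡-Reasoning

-- The induction step shared by `binomial-theorem` and `Δ^-expansion`: with E the shift of g, one
-- more factor 1 + E raises the order of a binomial sum by one.
Σ-binomℚ-suc : ∀ n g → Σℚ< (suc n) (λ k → binomℚ (ℕtoℚ n) k * (g (suc k) + g k)) ≡
               Σℚ< (suc (suc n)) (λ k → binomℚ (ℕtoℚ (suc n)) k * g k)
Σ-binomℚ-suc n g = begin
  Σℚ< (suc n) (λ k → c k * (g (suc k) + g k))
    ≡⟨ summation-by-parts n c g ⟩
  1ℚ * g 0 + Σℚ< n (λ k → (c k + c (suc k)) * g (suc k)) + c n * g (suc n)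
    ≡⟨ cong₂ (λ s t → 1ℚ * g 0 + s + t * g (suc n))
         (Σ-cong n (λ k _ → cong (_* g (suc k)) (trans (ℚP.+-comm (c k) (c (suc k))) (sym (binomℚ-ℕ-suc n k)))))
         (trans (binomℚ-ℕ-≡ n) (sym (binomℚ-ℕ-≡ (suc n)))) ⟩
  1ℚ * g 0 + Σℚ< n (λ k → c′ (suc k) * g (suc k)) + c′ (suc n) * g (suc n)
    ≡⟨ cong (_+ c′ (suc n) * g (suc n)) (Σ-first n (λ k → c′ k * g k)) ⟨
  Σℚ< (suc n) (λ k → c′ k * g k) + c′ (suc n) * g (suc n)
    ≡⟨ Σ-last (suc n) (λ k → c′ k * g k) ⟨
  Σℚ< (suc (suc n)) (λ k → c′ k * g k) ∎
  where
  open ≡-Reasoning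
  c c′ : ℕ → ℚ
  c  = binomℚ (ℕtoℚ n)
  c′ = binomℚ (ℕtoℚ (suc n))

sign-suc-suc : ∀ n → signℚ (suc (suc n)) ≡ signℚ n
sign-suc-suc n = ((∀ a → - (- a) ≡ a) ∋ solve-∀ ring) (signℚ n)

sign-+ : ∀ m n → signℚ (m ℕ.+ n) ≡ signℚ m * signℚ n
sign-+ zero    n = sym (ℚP.*-identityˡ (signℚ n))
sign-+ (suc m) n = trans (cong -_ (sign-+ m n)) (((∀ a b → - (a * b) ≡ - a * b) ∋ solve-∀ ring) (signℚ m) (signℚ n))

sign² : ∀ n → signℚ n * signℚ n ≡ 1ℚ
sign² zero    = refl
sign² (suc n) = trans (((∀ a → - a * - a ≡ a * a) ∋ solve-∀ ring) (signℚ n)) (sign² n)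

sign-∸ : ∀ {m j} → j ≤ m → signℚ (m ∸ j) ≡ signℚ m * signℚ j
sign-∸ {m} {j} j≤m = begin
  signℚ (m ∸ j)                              ≡⟨ ℚP.*-identityʳ (signℚ (m ∸ j)) ⟨
  signℚ (m ∸ j) * 1ℚ                         ≡⟨ cong (signℚ (m ∸ j) *_) (sign² j) ⟨
  signℚ (m ∸ j) * (signℚ j * signℚ j)        ≡⟨ ℚP.*-assoc (signℚ (m ∸ j)) (signℚ j) (signℚ j) ⟨
  signℚ (m ∸ j) * signℚ j * signℚ j          ≡⟨ cong (_* signℚ j) (sign-+ (m ∸ j) j) ⟨
  signℚ (m ∸ j ℕ.+ j) * signℚ j              ≡⟨ cong (λ n → signℚ n * signℚ j) (ℕP.m∸n+n≡m j≤m) ⟩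
  signℚ m * signℚ j                          ∎
  where open ≡-Reasoning

sign-even : ∀ k → signℚ (k ℕ.* 2) ≡ 1ℚ
sign-even zero    = refl
sign-even (suc k) = trans (sign-suc-suc (k ℕ.* 2)) (sign-even k)

-- Higher forward differences

Δ^ : ℕ → (ℚ → ℚ) → ℚ → ℚ
Δ^ zero    f y = f y
Δ^ (suc k) f y = Δ^ k f (y + 1ℚ) - Δ^ k f y

+-ℕtoℚ-suc : ∀ y j → y + 1ℚ + ℕtoℚ j ≡ y + ℕtoℚ (suc j)
+-ℕtoℚ-suc y j = trans (ℚP.+-assoc y 1ℚ (ℕtoℚ j)) (cong (y +_) (sym (ℕtoℚ-suc j)))

-- The usual sign (-1)^(k-j) is split into (-1)^k and (-1)^j. With the second absorbed into g j =
-- (-1)^j f(y+j), a difference of f becomes a sum of neighbours of g, as `Σ-binomℚ-suc` requires.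
Δ^-expansion : ∀ k f y → Δ^ k f y ≡ signℚ k * Σℚ< (suc k) (λ j → binomℚ (ℕtoℚ k) j * (signℚ j * f (y + ℕtoℚ j)))
Δ^-expansion zero    f y = trans (cong f (sym (ℚP.+-identityʳ y)))
  (((∀ a → a ≡ 1ℚ * (1ℚ * (1ℚ * a) + 0ℚ)) ∋ solve-∀ ring) (f (y + 0ℚ)))
Δ^-expansion (suc k) f y = begin
  Δ^ k f (y + 1ℚ) - Δ^ k f y
    ≡⟨ cong₂ _-_ (Δ^-expansion k f (y + 1ℚ)) (Δ^-expansion k f y) ⟩
  signℚ k * Σℚ< (suc k) s₁ - signℚ k * Σℚ< (suc k) s₀
    ≡⟨ ((∀ s a b → s * a - s * b ≡ - s * (- 1ℚ * a + b)) ∋ solve-∀ ring) (signℚ k) (Σℚ< (suc k) s₁) (Σℚ< (suc k) s₀) ⟩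
  - signℚ k * (- 1ℚ * Σℚ< (suc k) s₁ + Σℚ< (suc k) s₀)
    ≡⟨ cong (λ a → - signℚ k * (a + Σℚ< (suc k) s₀)) (Σ-*ˡ (suc k) (- 1ℚ) s₁) ⟨
  - signℚ k * (Σℚ< (suc k) (λ j → - 1ℚ * s₁ j) + Σℚ< (suc k) s₀)
    ≡⟨ cong (- signℚ k *_) (Σ-+ (suc k) (λ j → - 1ℚ * s₁ j) s₀) ⟨
  - signℚ k * Σℚ< (suc k) (λ j → - 1ℚ * s₁ j + s₀ j)
    ≡⟨ cong (- signℚ k *_) (Σ-cong (suc k) (λ j _ → collect j)) ⟩
  - signℚ k * Σℚ< (suc k) (λ j → binomℚ (ℕtoℚ k) j * (g (suc j) + g j))
    ≡⟨ cong (- signℚ k *_) (Σ-binomℚ-suc k g) ⟩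
  - signℚ k * Σℚ< (suc (suc k)) (λ j → binomℚ (ℕtoℚ (suc k)) j * g j) ∎
  where
  open ≡-Reasoning
  s₀ s₁ g : ℕ → ℚ
  s₀ j = binomℚ (ℕtoℚ k) j * (signℚ j * f (y + ℕtoℚ j))
  s₁ j = binomℚ (ℕtoℚ k) j * (signℚ j * f (y + 1ℚ + ℕtoℚ j))
  g j = signℚ j * f (y + ℕtoℚ j)
  collect : ∀ j → - 1ℚ * s₁ j + s₀ j ≡ binomℚ (ℕtoℚ k) j * (g (suc j) + g j)
  collect j = trans
    (cong (λ z → - 1ℚ * (binomℚ (ℕtoℚ k) j * (signℚ j * f z)) + s₀ j) (+-ℕtoℚ-suc y j))
    (((∀ b s u v → - 1ℚ * (b * (s * u)) + b * (s * v) ≡ b * (- s * u + s * v)) ∋ solve-∀ ring)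
      (binomℚ (ℕtoℚ k) j) (signℚ j) (f (y + ℕtoℚ (suc j))) (f (y + ℕtoℚ j)))

-- Generating function of the Gregory polynomials

log·G : ∀ x → logOver ·S (λ n → G n x) ≗S binomSeries x
log·G x n = begin
  (logOver ·S (invS logOver ·S binomSeries x)) n    ≡⟨ ·S-assoc logOver (invS logOver) (binomSeries x) n ⟨
  ((logOver ·S invS logOver) ·S binomSeries x) n    ≡⟨ ·S-cong {g = binomSeries x} (invS-inverseʳ logOver refl) (λ _ → refl) n ⟩
  (1S ·S binomSeries x) n                           ≡⟨ ·S-identityˡ (binomSeries x) n ⟩
  binomSeries x n                                   ∎
  where open ≡-Reasoning

-- F_{x+1} = (1+t) F_x: only the binomial factor depends on x, and there the identity is Pascal's
-- rule.
G-suc : ∀ n x → G (suc n) (x + 1ℚ) ≡ G (suc n) x + G n x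
G-suc n x = begin
  (I ·S binomSeries (x + 1ℚ)) (suc n)              ≡⟨ ·S-cong {I} (λ _ → refl) pascal (suc n) ⟩
  (I ·S (B +S shift B)) (suc n)                    ≡⟨ ·S-distribˡ-+S I B (shift B) (suc n) ⟩
  (I ·S B) (suc n) + (I ·S shift B) (suc n)        ≡⟨ cong ((I ·S B) (suc n) +_) (·S-tailʳ I (shift B) n refl) ⟩
  (I ·S B) (suc n) + (I ·S B) n                    ∎
  where
  open ≡-Reasoning
  I = invS logOver
  B = binomSeries x
  pascal : binomSeries (x + 1ℚ) ≗S B +S shift B
  pascal zero    = refl
  pascal (suc k) = binomℚ-pascal x k

-- The operator η and the functionals φ n

-- η is the operator 1 + (1+t) d/dt, and φ n f the constant term of ηⁿ f.
η : Series → Series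
η f n = ℕtoℚ (suc n) * (f n + f (suc n))

φ : ℕ → Series → ℚ
φ zero    f = f 0
φ (suc n) f = φ n (η f)

φ-cong : ∀ n {f g} → f ≗S g → φ n f ≡ φ n g
φ-cong zero    f≗g = f≗g 0
φ-cong (suc n) f≗g = φ-cong n (λ k → cong₂ (λ a b → ℕtoℚ (suc k) * (a + b)) (f≗g k) (f≗g (suc k)))

φ-+ : ∀ n f g → φ n (f +S g) ≡ φ n f + φ n g
φ-+ zero    f g = refl
φ-+ (suc n) f g = trans (φ-cong n (λ k → distrib (ℕtoℚ (suc k)) (f k) (g k) (f (suc k)) (g (suc k)))) (φ-+ n (η f) (η g))
  where
  distrib : ∀ s a b c d → s * ((a + b) + (c + d)) ≡ s * (a + c) + s * (b + d)
  distrib = solve-∀ ring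

φ-scale : ∀ n c f → φ n (λ k → c * f k) ≡ c * φ n f
φ-scale zero    c f = refl
φ-scale (suc n) c f = trans (φ-cong n (λ k → distrib (ℕtoℚ (suc k)) c (f k) (f (suc k)))) (φ-scale n c (η f))
  where
  distrib : ∀ s c a b → s * (c * a + c * b) ≡ c * (s * (a + b))
  distrib = solve-∀ ring

-- (1+t)^y has constant term 1 and is an eigenvector of `η` with eigenvalue y+1.
φ-binom : ∀ n y → φ n (binomSeries y) ≡ powℚ (y + 1ℚ) n
φ-binom zero    y = refl
φ-binom (suc n) y = begin
  φ n (η (binomSeries y))                      ≡⟨ φ-cong n eigen ⟩
  φ n (λ k → (y + 1ℚ) * binomℚ y k)            ≡⟨ φ-scale n (y + 1ℚ) (binomSeries y) ⟩
  (y + 1ℚ) * φ n (binomSeries y)               ≡⟨ cong ((y + 1ℚ) *_) (φ-binom n y) ⟩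
  (y + 1ℚ) * powℚ (y + 1ℚ) n                   ∎
  where
  open ≡-Reasoning
  eigen : ∀ k → ℕtoℚ (suc k) * (binomℚ y k + binomℚ y (suc k)) ≡ (y + 1ℚ) * binomℚ y k
  eigen k = begin
    ℕtoℚ (suc k) * (binomℚ y k + binomℚ y (suc k))                  ≡⟨ ℚP.*-distribˡ-+ (ℕtoℚ (suc k)) (binomℚ y k) (binomℚ y (suc k)) ⟩
    ℕtoℚ (suc k) * binomℚ y k + ℕtoℚ (suc k) * binomℚ y (suc k)     ≡⟨ cong₂ (λ s b → s * binomℚ y k + b) (ℕtoℚ-suc k) (binomℚ-suc y k) ⟩
    (1ℚ + ℕtoℚ k) * binomℚ y k + (y - ℕtoℚ k) * binomℚ y k          ≡⟨ ((∀ y k b → (1ℚ + k) * b + (y - k) * b ≡ (y + 1ℚ) * b) ∋ solve-∀ ring) y (ℕtoℚ k) (binomℚ y k) ⟩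
    (y + 1ℚ) * binomℚ y k                                           ∎

log : Series
log = shift logOver

euler : Series → Series
euler f n = ℕtoℚ n * f n

-- The degree n of a term splits as k + (n-k). Using t d/dt in place of d/dt keeps degrees fixed, so
-- Leibniz holds term by term.
euler-·S : ∀ f g → euler (f ·S g) ≗S (euler f ·S g) +S (f ·S euler g)
euler-·S f g n = begin
  ℕtoℚ n * Σℚ< (suc n) (λ k → f k * g (n ∸ k))
    ≡⟨ Σ-*ˡ (suc n) (ℕtoℚ n) (λ k → f k * g (n ∸ k)) ⟨
  Σℚ< (suc n) (λ k → ℕtoℚ n * (f k * g (n ∸ k)))
    ≡⟨ Σ-cong (suc n) (λ k k<1+n → leibniz k (ℕP.≤-pred k<1+n)) ⟩
  Σℚ< (suc n) (λ k → euler f k * g (n ∸ k) + f k * euler g (n ∸ k))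
    ≡⟨ Σ-+ (suc n) (λ k → euler f k * g (n ∸ k)) (λ k → f k * euler g (n ∸ k)) ⟩
  (euler f ·S g) n + (f ·S euler g) n ∎
  where
  open ≡-Reasoning
  leibniz : ∀ k → k ≤ n → ℕtoℚ n * (f k * g (n ∸ k)) ≡ euler f k * g (n ∸ k) + f k * euler g (n ∸ k)
  leibniz k k≤n = trans
    (cong (_* (f k * g (n ∸ k))) (trans (cong ℕtoℚ (sym (ℕP.m+[n∸m]≡n k≤n))) (ℕtoℚ-+ k (n ∸ k))))
    (((∀ k l a b → (k + l) * (a * b) ≡ k * a * b + a * (l * b)) ∋ solve-∀ ring) (ℕtoℚ k) (ℕtoℚ (n ∸ k)) (f k) (g (n ∸ k)))

euler-log : euler log ≗S shift signℚ
euler-log zero    = refl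
euler-log (suc n) = trans
  (((∀ a s r → a * (s * r) ≡ a * r * s) ∋ solve-∀ ring) (ℕtoℚ (suc n)) (signℚ n) (recipℕ (suc n)))
  (trans (cong (_* signℚ n) (*-recipℕ (suc n))) (ℚP.*-identityˡ (signℚ n)))

-- The identity 1/(1+t) + t/(1+t) = 1. Together with `euler-log` it says that (1+t) d/dt log(1+t) =
-- 1.
sign+shift-sign : signℚ +S shift signℚ ≗S 1S
sign+shift-sign zero    = refl
sign+shift-sign (suc n) = ℚP.+-inverseˡ (signℚ n)

-- The Leibniz rule, with (1+t) d/dt log(1+t) = 1.
η-log : ∀ g → η (log ·S g) ≗S g +S (log ·S η g)
η-log g n = begin
  ℕtoℚ (suc n) * (f n + f (suc n))
    ≡⟨ cong (λ s → s * (f n + f (suc n))) (ℕtoℚ-suc n) ⟩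
  (1ℚ + ℕtoℚ n) * (f n + f (suc n))
    ≡⟨ ((∀ n a b → (1ℚ + n) * (a + b) ≡ n * a + (1ℚ + n) * b + a) ∋ solve-∀ ring) (ℕtoℚ n) (f n) (f (suc n)) ⟩
  ℕtoℚ n * f n + (1ℚ + ℕtoℚ n) * f (suc n) + f n
    ≡⟨ cong (λ s → ℕtoℚ n * f n + s * f (suc n) + f n) (ℕtoℚ-suc n) ⟨
  -- The first two summands form coefficient n of (1+t) df/dt, since df/dt is the tail of t df/dt.
  euler f n + euler f (suc n) + f n
    ≡⟨ cong₂ (λ a b → a + b + f n) (euler-f n) (euler-f (suc n)) ⟩
  ((shift signℚ ·S g) n + (log ·S e) n) + ((shift signℚ ·S g) (suc n) + (log ·S e) (suc n)) + f n
    ≡⟨ cong₂ (λ a b → ((shift signℚ ·S g) n + (log ·S e) n) + (a + b) + f n)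
         (·S-shiftˡ signℚ g n) (·S-tailʳ log e n (ℚP.*-zeroˡ (g 0))) ⟩
  ((shift signℚ ·S g) n + (log ·S e) n) + ((signℚ ·S g) n + (log ·S tail e) n) + f n
    ≡⟨ ((∀ a b c d f → a + b + (c + d) + f ≡ (c + a) + (b + d + f)) ∋ solve-∀ ring)
         ((shift signℚ ·S g) n) ((log ·S e) n) ((signℚ ·S g) n) ((log ·S tail e) n) (f n) ⟩
  ((signℚ ·S g) n + (shift signℚ ·S g) n) + ((log ·S e) n + (log ·S tail e) n + (log ·S g) n)
    ≡⟨ cong₂ _+_
         (trans (sym (·S-distribʳ-+S signℚ (shift signℚ) g n))
           (trans (·S-cong {g = g} sign+shift-sign (λ _ → refl) n) (·S-identityˡ g n)))
         (trans (cong (_+ (log ·S g) n) (sym (·S-distribˡ-+S log e (tail e) n)))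
           (trans (sym (·S-distribˡ-+S log (e +S tail e) g n)) (·S-cong {log} (λ _ → refl) η-split n))) ⟩
  g n + (log ·S η g) n ∎
  where
  open ≡-Reasoning
  f = log ·S g
  e = euler g
  euler-f : ∀ n → euler f n ≡ (shift signℚ ·S g) n + (log ·S e) n
  euler-f n = trans (euler-·S log g n) (cong (_+ (log ·S e) n) (·S-cong {g = g} euler-log (λ _ → refl) n))
  η-split : (e +S tail e) +S g ≗S η g
  η-split k = trans
    (cong (λ s → ℕtoℚ k * g k + s * g (suc k) + g k) (ℕtoℚ-suc k))
    (trans (((∀ k a b → k * a + (1ℚ + k) * b + a ≡ (1ℚ + k) * (a + b)) ∋ solve-∀ ring) (ℕtoℚ k) (g k) (g (suc k)))
      (cong (_* (g k + g (suc k))) (sym (ℕtoℚ-suc k))))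

-- By `η-log` the commutator of η with multiplication by log(1+t) is the identity, so η^(n+1) log =
-- log η^(n+1) + (n+1) η^n as operators. The first summand has no constant term, because log(1+t)
-- has none.
φ-log : ∀ n g → φ (suc n) (log ·S g) ≡ ℕtoℚ (suc n) * φ n g
φ-log n g = begin
  φ n (η (log ·S g))                        ≡⟨ φ-cong n (η-log g) ⟩
  φ n (g +S (log ·S η g))                   ≡⟨ φ-+ n g (log ·S η g) ⟩
  φ n g + φ n (log ·S η g)                  ≡⟨ cong (φ n g +_) (rest n) ⟩
  φ n g + ℕtoℚ n * φ n g                    ≡⟨ ((∀ a n → a + n * a ≡ (1ℚ + n) * a) ∋ solve-∀ ring) (φ n g) (ℕtoℚ n) ⟩
  (1ℚ + ℕtoℚ n) * φ n g                     ≡⟨ cong (_* φ n g) (ℕtoℚ-suc n) ⟨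
  ℕtoℚ (suc n) * φ n g                      ∎
  where
  open ≡-Reasoning
  rest : ∀ n → φ n (log ·S η g) ≡ ℕtoℚ n * φ n g
  rest zero    = trans (·S-zero log (η g)) (trans (ℚP.*-zeroˡ (η g 0)) (sym (ℚP.*-zeroˡ (g 0))))
  rest (suc n) = φ-log n (η g)

φ-G : ∀ n x → ℕtoℚ (suc n) * φ n (λ k → G k x) ≡ powℚ (x + 1ℚ + 1ℚ) (suc n) - powℚ (x + 1ℚ) (suc n)
φ-G n x = begin
  ℕtoℚ (suc n) * φ n (λ k → G k x)                                 ≡⟨ φ-log n (λ k → G k x) ⟨
  φ (suc n) (log ·S (λ k → G k x))                                 ≡⟨ a+b≡c⇒b≡c-a (φ (suc n) (binomSeries x)) (φ (suc n) (log ·S (λ k → G k x))) sum ⟩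
  φ (suc n) (binomSeries (x + 1ℚ)) - φ (suc n) (binomSeries x)     ≡⟨ cong₂ _-_ (φ-binom (suc n) (x + 1ℚ)) (φ-binom (suc n) x) ⟩
  powℚ (x + 1ℚ + 1ℚ) (suc n) - powℚ (x + 1ℚ) (suc n)               ∎
  where
  open ≡-Reasoning
  a+b≡c⇒b≡c-a : ∀ a b {c} → a + b ≡ c → b ≡ c - a
  a+b≡c⇒b≡c-a a b refl = ((∀ a b → b ≡ a + b - a) ∋ solve-∀ ring) a b
  -- log(1+t) F_x is t (1+t)^x, so this is Pascal's rule; in additive form it can be fed to `φ-+`.
  pointwise : binomSeries x +S (log ·S (λ k → G k x)) ≗S binomSeries (x + 1ℚ)
  pointwise zero    = refl
  pointwise (suc k) = trans
    (cong (binomℚ x (suc k) +_) (trans (·S-shiftˡ logOver (λ k → G k x) k) (log·G x k)))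
    (sym (binomℚ-pascal x k))
  sum : φ (suc n) (binomSeries x) + φ (suc n) (log ·S (λ k → G k x)) ≡ φ (suc n) (binomSeries (x + 1ℚ))
  sum = trans (sym (φ-+ (suc n) (binomSeries x) (log ·S (λ k → G k x)))) (φ-cong (suc n) pointwise)

-- v n k = k! S(n+1, k+1), with S the Stirling numbers of the second kind.
v : ℕ → ℕ → ℕ
v zero    zero    = 1
v zero    (suc k) = 0
v (suc n) zero    = v n zero
v (suc n) (suc k) = suc (suc k) ℕ.* v n (suc k) ℕ.+ suc k ℕ.* v n k

v-zeroʳ : ∀ n → v n 0 ≡ 1
v-zeroʳ zero    = refl
v-zeroʳ (suc n) = v-zeroʳ n

v-< : ∀ {n k} → n < k → v n k ≡ 0
v-< {zero}  {suc k} _ = refl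
v-< {suc n} {suc k} (s≤s n<k) rewrite v-< (ℕP.m<n⇒m<1+n n<k) | v-< n<k | ℕP.*-zeroʳ k = refl

v-diagonal : ∀ n → v n n ≡ n !
v-diagonal zero    = refl
v-diagonal (suc n) rewrite v-< (ℕP.n<1+n n) | v-diagonal n | ℕP.*-zeroʳ n = refl

-- The recursion of `v` is the transpose of `η`: summation by parts moves the neighbour sum from the
-- coefficients of f to the weights. The top weight fits the recursion because `v n (suc n)` is 0.
φ-expansion : ∀ n f → φ n f ≡ Σℚ< (suc n) (λ k → ℕtoℚ (v n k) * f k)
φ-expansion zero    f = ((∀ a → a ≡ 1ℚ * a + 0ℚ) ∋ solve-∀ ring) (f 0)
φ-expansion (suc n) f = begin
  φ n (η f)
    ≡⟨ φ-expansion n (η f) ⟩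
  Σℚ< (suc n) (λ k → ℕtoℚ (v n k) * (ℕtoℚ (suc k) * (f k + f (suc k))))
    ≡⟨ Σ-cong (suc n) (λ k _ → regroup (v n k) k (f k) (f (suc k))) ⟩
  Σℚ< (suc n) (λ k → c k * (f (suc k) + f k))
    ≡⟨ summation-by-parts n c f ⟩
  c 0 * f 0 + Σℚ< n (λ k → (c k + c (suc k)) * f (suc k)) + c n * f (suc n)
    ≡⟨ cong₂ (λ a b → a + b + c n * f (suc n)) (cong (λ a → ℕtoℚ a * f 0) (ℕP.*-identityˡ (v n 0)))
         (Σ-cong n (λ k _ → cong (_* f (suc k)) (combine k))) ⟩
  w 0 * f 0 + Σℚ< n (λ k → w (suc k) * f (suc k)) + c n * f (suc n)
    ≡⟨ cong₂ _+_ (sym (Σ-first n (λ k → w k * f k))) (cong (λ a → ℕtoℚ a * f (suc n)) last-weight) ⟩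
  Σℚ< (suc n) (λ k → w k * f k) + w (suc n) * f (suc n)
    ≡⟨ Σ-last (suc n) (λ k → w k * f k) ⟨
  Σℚ< (suc (suc n)) (λ k → w k * f k) ∎
  where
  open ≡-Reasoning
  c w : ℕ → ℚ
  c k = ℕtoℚ (suc k ℕ.* v n k)
  w k = ℕtoℚ (v (suc n) k)
  regroup : ∀ u k a b → ℕtoℚ u * (ℕtoℚ (suc k) * (a + b)) ≡ ℕtoℚ (suc k ℕ.* u) * (b + a)
  regroup u k a b = trans (((∀ u s a b → u * (s * (a + b)) ≡ s * u * (b + a)) ∋ solve-∀ ring) (ℕtoℚ u) (ℕtoℚ (suc k)) a b)
    (cong (_* (b + a)) (sym (ℕtoℚ-* (suc k) u)))
  combine : ∀ k → c k + c (suc k) ≡ w (suc k)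
  combine k = trans (ℚP.+-comm (c k) (c (suc k)))
    (sym (ℕtoℚ-+ (suc (suc k) ℕ.* v n (suc k)) (suc k ℕ.* v n k)))
  last-weight : suc n ℕ.* v n n ≡ suc (suc n) ℕ.* v n (suc n) ℕ.+ suc n ℕ.* v n n
  last-weight rewrite v-< (ℕP.n<1+n n) | ℕP.*-zeroʳ n = refl

-- Congruences modulo p between p-integral rational numbers

↥≡*↧ : ∀ q → q * ℕtoℚ (ℚ.denominatorℕ q) ≡ ℤtoℚ (↥ q)
↥≡*↧ q@(mkℚ n d-1 c) = ℚP.toℚᵘ-injective (begin
  toℚᵘ (q * ℕtoℚ (suc d-1))              ≈⟨ ℚP.toℚᵘ-homo-* q (ℕtoℚ (suc d-1)) ⟩
  mkℚᵘ n d-1 ℚᵘ.* toℚᵘ (ℕtoℚ (suc d-1))   ≈⟨ ℚᵘP.*-congˡ {mkℚᵘ n d-1} (toℚᵘ-ℤtoℚ (ℤ.+ suc d-1)) ⟩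
  mkℚᵘ n d-1 ℚᵘ.* mkℚᵘ (ℤ.+ suc d-1) 0    ≈⟨ *≡* (trans (ℤP.*-identityʳ _) (cong (n ℤ.*_) (cong ℤ.+_ (sym (ℕP.*-identityʳ (suc d-1)))))) ⟩
  mkℚᵘ n 0                               ≈⟨ toℚᵘ-ℤtoℚ n ⟨
  toℚᵘ (ℤtoℚ n)                          ∎)
  where open ℚᵘP.≃-Reasoning

powℚ-* : ∀ a b n → powℚ (a * b) n ≡ powℚ a n * powℚ b n
powℚ-* a b zero    = refl
powℚ-* a b (suc n) = trans (cong (a * b *_) (powℚ-* a b n))
  (((∀ a b x y → a * b * (x * y) ≡ a * x * (b * y)) ∋ solve-∀ ring) a b (powℚ a n) (powℚ b n))

ℤtoℚ-^ : ∀ z n → ℤtoℚ (z ℤ.^ n) ≡ powℚ (ℤtoℚ z) n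
ℤtoℚ-^ z zero    = refl
ℤtoℚ-^ z (suc n) = trans (ℤtoℚ-* z (z ℤ.^ n)) (cong (ℤtoℚ z *_) (ℤtoℚ-^ z n))

binomial-theorem : ∀ y n → powℚ (y + 1ℚ) n ≡ Σℚ< (suc n) (λ k → binomℚ (ℕtoℚ n) k * powℚ y k)
binomial-theorem y zero    = refl
binomial-theorem y (suc n) = begin
  (y + 1ℚ) * powℚ (y + 1ℚ) n
    ≡⟨ cong ((y + 1ℚ) *_) (binomial-theorem y n) ⟩
  (y + 1ℚ) * Σℚ< (suc n) (λ k → c k * powℚ y k)
    ≡⟨ Σ-*ˡ (suc n) (y + 1ℚ) (λ k → c k * powℚ y k) ⟨
  Σℚ< (suc n) (λ k → (y + 1ℚ) * (c k * powℚ y k))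
    ≡⟨ Σ-cong (suc n) (λ k _ → ((∀ y c p → (y + 1ℚ) * (c * p) ≡ c * (y * p + p)) ∋ solve-∀ ring) y (c k) (powℚ y k)) ⟩
  Σℚ< (suc n) (λ k → c k * (powℚ y (suc k) + powℚ y k))
    ≡⟨ Σ-binomℚ-suc n (powℚ y) ⟩
  Σℚ< (suc (suc n)) (λ k → binomℚ (ℕtoℚ (suc n)) k * powℚ y k) ∎
  where
  open ≡-Reasoning
  c = binomℚ (ℕtoℚ n)

module Localization {p : ℕ} (p-prime : Prime p) where

  instance
    p≢0 : NonZero p
    p≢0 = prime⇒nonZero p-prime

  -- Membership in the localisation of ℤ at p. The fraction need not be reduced, so sums and
  -- products are formed without any gcd.
  record Integral (q : ℚ) : Set where
    constructor integral
    field
      den     : ℕ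
      num     : ℤ
      p∤den   : p ∤ den
      q*den≡num : q * ℕtoℚ den ≡ ℤtoℚ num

  infix 4 _≈_
  -- Only the difference has to be p-integral. Rationals with p in the denominator, such as `G q x`
  -- and 1/p, may therefore occur on both sides; integrality is demanded only when congruences are
  -- multiplied.
  record _≈_ (a b : ℚ) : Set where
    constructor congruent
    field
      quotient          : ℚ
      quotient-integral : Integral quotient
      difference        : a - b ≡ ℕtoℚ p * quotient

  <⇒∤ : ∀ {n} .{{_ : NonZero n}} → n < p → p ∤ n
  <⇒∤ n<p p∣n = ℕP.<⇒≱ n<p (ℕD.∣⇒≤ p∣n)

  ∤-* : ∀ {m n} → p ∤ m → p ∤ n → p ∤ m ℕ.* n
  ∤-* {m} {n} p∤m p∤n p∣mn = [ p∤m , p∤n ]′ (euclidsLemma m n p-prime p∣mn)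

  ∤⇒NonZero : ∀ {n} → p ∤ n → NonZero n
  ∤⇒NonZero {zero}  p∤0 = contradiction (divides 0 refl) p∤0
  ∤⇒NonZero {suc n} _   = _

  ℤ-integral : ∀ z → Integral (ℤtoℚ z)
  ℤ-integral z = integral 1 z (λ p∣1 → ℕP.<⇒≱ (ℕ.nonTrivial⇒n>1 p {{prime⇒nonTrivial p-prime}}) (ℕD.∣⇒≤ p∣1)) (ℚP.*-identityʳ (ℤtoℚ z))

  ℕ-integral : ∀ n → Integral (ℕtoℚ n)
  ℕ-integral n = ℤ-integral (ℤ.+ n)

  +-integral : ∀ {a b} → Integral a → Integral b → Integral (a + b)
  +-integral {a} {b} (integral d n p∤d ad≡n) (integral e m p∤e be≡m) =
    integral (d ℕ.* e) (n ℤ.* ℤ.+ e ℤ.+ m ℤ.* ℤ.+ d) (∤-* p∤d p∤e) (begin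
      (a + b) * ℕtoℚ (d ℕ.* e)                        ≡⟨ cong ((a + b) *_) (ℕtoℚ-* d e) ⟩
      (a + b) * (ℕtoℚ d * ℕtoℚ e)                     ≡⟨ ((∀ a b d e → (a + b) * (d * e) ≡ a * d * e + b * e * d) ∋ solve-∀ ring) a b (ℕtoℚ d) (ℕtoℚ e) ⟩
      a * ℕtoℚ d * ℕtoℚ e + b * ℕtoℚ e * ℕtoℚ d       ≡⟨ cong₂ (λ x y → x * ℕtoℚ e + y * ℕtoℚ d) ad≡n be≡m ⟩
      ℤtoℚ n * ℕtoℚ e + ℤtoℚ m * ℕtoℚ d               ≡⟨ cong₂ _+_ (ℤtoℚ-* n (ℤ.+ e)) (ℤtoℚ-* m (ℤ.+ d)) ⟨
      ℤtoℚ (n ℤ.* ℤ.+ e) + ℤtoℚ (m ℤ.* ℤ.+ d)         ≡⟨ ℤtoℚ-+ (n ℤ.* ℤ.+ e) (m ℤ.* ℤ.+ d) ⟨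
      ℤtoℚ (n ℤ.* ℤ.+ e ℤ.+ m ℤ.* ℤ.+ d)              ∎)
    where open ≡-Reasoning

  *-integral : ∀ {a b} → Integral a → Integral b → Integral (a * b)
  *-integral {a} {b} (integral d n p∤d ad≡n) (integral e m p∤e be≡m) =
    integral (d ℕ.* e) (n ℤ.* m) (∤-* p∤d p∤e) (begin
      a * b * ℕtoℚ (d ℕ.* e)            ≡⟨ cong (a * b *_) (ℕtoℚ-* d e) ⟩
      a * b * (ℕtoℚ d * ℕtoℚ e)         ≡⟨ ((∀ a b d e → a * b * (d * e) ≡ (a * d) * (b * e)) ∋ solve-∀ ring) a b (ℕtoℚ d) (ℕtoℚ e) ⟩
      (a * ℕtoℚ d) * (b * ℕtoℚ e)       ≡⟨ cong₂ _*_ ad≡n be≡m ⟩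
      ℤtoℚ n * ℤtoℚ m                   ≡⟨ ℤtoℚ-* n m ⟨
      ℤtoℚ (n ℤ.* m)                    ∎)
    where open ≡-Reasoning

  neg-integral : ∀ {a} → Integral a → Integral (- a)
  neg-integral {a} a-int = subst Integral (((∀ a → - 1ℚ * a ≡ - a) ∋ solve-∀ ring) a) (*-integral (ℤ-integral (ℤ.- ℤ.1ℤ)) a-int)

  sub-integral : ∀ {a b} → Integral a → Integral b → Integral (a - b)
  sub-integral a-int b-int = +-integral a-int (neg-integral b-int)

  recipℕ-integral : ∀ {n} → p ∤ n → Integral (recipℕ n)
  recipℕ-integral {n} p∤n = integral n ℤ.1ℤ p∤n (trans (ℚP.*-comm (recipℕ n) (ℕtoℚ n)) (*-recipℕ n {{∤⇒NonZero p∤n}}))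

  sign-integral : ∀ n → Integral (signℚ n)
  sign-integral zero    = ℕ-integral 1
  sign-integral (suc n) = neg-integral (sign-integral n)

  pow-integral : ∀ {a} → Integral a → ∀ n → Integral (powℚ a n)
  pow-integral a-int zero    = ℕ-integral 1
  pow-integral a-int (suc n) = *-integral a-int (pow-integral a-int n)

  Σ-integral : ∀ n f → (∀ i → i < n → Integral (f i)) → Integral (Σℚ< n f)
  Σ-integral = Σ-induction Integral (ℕ-integral 0) +-integral

  cancel-integral : ∀ {n a} → p ∤ n → Integral (ℕtoℚ n * a) → Integral a
  cancel-integral {n} {a} p∤n na-int = subst Integral (recip-* n {{∤⇒NonZero p∤n}} a) (*-integral (recipℕ-integral p∤n) na-int)

  binom-integral : ∀ {x k} → Integral x → k < p → Integral (binomℚ x k)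
  binom-integral {x} {zero}  x-int _     = ℕ-integral 1
  binom-integral {x} {suc k} x-int 1+k<p = cancel-integral (<⇒∤ 1+k<p)
    (subst Integral (sym (binomℚ-suc x k))
      (*-integral (sub-integral x-int (ℕ-integral k)) (binom-integral x-int (ℕP.<-trans (ℕP.n<1+n k) 1+k<p))))

  small-denominator⇒integral : ∀ q → ℚ.denominatorℕ q < p → Integral q
  small-denominator⇒integral q@(mkℚ _ _ _) d<p = integral (ℚ.denominatorℕ q) (↥ q) (<⇒∤ d<p) (↥≡*↧ q)

  -- Let q = n/d in lowest terms, and also q = m/e with p not dividing e. Then n e = m d, so if p
  -- divided d it would divide n, against coprimality. This keeps `redℚ` out of its default branch.
  integral⇒∤denominator : ∀ {q} → Integral q → p ∤ ℚ.denominatorℕ q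
  integral⇒∤denominator {q@(mkℚ n d-1 c)} (integral e m p∤e qe≡m) p∣d =
    [ p∤n , p∤e ]′ (euclidsLemma ℤ.∣ n ∣ e p-prime p∣ne)
    where
    d = suc d-1
    p∤n : p ∤ ℤ.∣ n ∣
    p∤n p∣n = ℕP.<⇒≢ (ℕ.nonTrivial⇒n>1 p {{prime⇒nonTrivial p-prime}}) (sym (Coprimality.recompute c (p∣n , p∣d)))
    ne≡md : n ℤ.* ℤ.+ e ≡ m ℤ.* ℤ.+ d
    ne≡md = ℤtoℚ-injective _ _ (begin
      ℤtoℚ (n ℤ.* ℤ.+ e)     ≡⟨ ℤtoℚ-* n (ℤ.+ e) ⟩
      ℤtoℚ n * ℕtoℚ e        ≡⟨ cong (_* ℕtoℚ e) (↥≡*↧ q) ⟨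
      q * ℕtoℚ d * ℕtoℚ e    ≡⟨ ((∀ q d e → q * d * e ≡ q * e * d) ∋ solve-∀ ring) q (ℕtoℚ d) (ℕtoℚ e) ⟩
      q * ℕtoℚ e * ℕtoℚ d    ≡⟨ cong (_* ℕtoℚ d) qe≡m ⟩
      ℤtoℚ m * ℕtoℚ d        ≡⟨ ℤtoℚ-* m (ℤ.+ d) ⟨
      ℤtoℚ (m ℤ.* ℤ.+ d)     ∎)
      where open ≡-Reasoning
    p∣ne : p ∣ ℤ.∣ n ∣ ℕ.* e
    p∣ne = subst (p ∣_) (trans (sym (ℤP.abs-* m (ℤ.+ d))) (trans (cong ℤ.∣_∣ (sym ne≡md)) (ℤP.abs-* n (ℤ.+ e))))
      (ℕD.∣n⇒∣m*n ℤ.∣ m ∣ p∣d)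

  ≡⇒≈ : ∀ {a b} → a ≡ b → a ≈ b
  ≡⇒≈ {a} refl = congruent 0ℚ (ℕ-integral 0) (trans (ℚP.+-inverseʳ a) (sym (ℚP.*-zeroʳ (ℕtoℚ p))))

  ≈-refl : ∀ {a} → a ≈ a
  ≈-refl = ≡⇒≈ refl

  ≈-sym : ∀ {a b} → a ≈ b → b ≈ a
  ≈-sym {a} {b} (congruent s s-int e) = congruent (- s) (neg-integral s-int) (begin
    b - a              ≡⟨ ((∀ a b → b - a ≡ - (a - b)) ∋ solve-∀ ring) a b ⟩
    - (a - b)          ≡⟨ cong -_ e ⟩
    - (ℕtoℚ p * s)     ≡⟨ ((∀ q s → - (q * s) ≡ q * - s) ∋ solve-∀ ring) (ℕtoℚ p) s ⟩
    ℕtoℚ p * - s       ∎)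
    where open ≡-Reasoning

  ≈-trans : ∀ {a b c} → a ≈ b → b ≈ c → a ≈ c
  ≈-trans {a} {b} {c} (congruent s s-int e) (congruent t t-int f) = congruent (s + t) (+-integral s-int t-int) (begin
    a - c                        ≡⟨ ((∀ a b c → a - c ≡ (a - b) + (b - c)) ∋ solve-∀ ring) a b c ⟩
    (a - b) + (b - c)            ≡⟨ cong₂ _+_ e f ⟩
    ℕtoℚ p * s + ℕtoℚ p * t      ≡⟨ ℚP.*-distribˡ-+ (ℕtoℚ p) s t ⟨
    ℕtoℚ p * (s + t)             ∎)
    where open ≡-Reasoning

  ≈-setoid : Setoid _ _
  ≈-setoid = record
    { Carrier = ℚ ; _≈_ = _≈_
    ; isEquivalence = record { refl = ≈-refl ; sym = ≈-sym ; trans = ≈-trans } }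

  module ≈-Reasoning = SetoidReasoning ≈-setoid

  ≈-integral : ∀ {a b} → a ≈ b → Integral b → Integral a
  ≈-integral {a} {b} (congruent s s-int e) b-int = subst Integral
    (trans (cong (_+ b) (sym e)) (((∀ a b → a - b + b ≡ a) ∋ solve-∀ ring) a b))
    (+-integral (*-integral (ℕ-integral p) s-int) b-int)

  +-cong : ∀ {a b c d} → a ≈ b → c ≈ d → a + c ≈ b + d
  +-cong {a} {b} {c} {d} (congruent s s-int e) (congruent t t-int f) = congruent (s + t) (+-integral s-int t-int) (begin
    a + c - (b + d)              ≡⟨ ((∀ a b c d → a + c - (b + d) ≡ (a - b) + (c - d)) ∋ solve-∀ ring) a b c d ⟩
    (a - b) + (c - d)            ≡⟨ cong₂ _+_ e f ⟩
    ℕtoℚ p * s + ℕtoℚ p * t      ≡⟨ ℚP.*-distribˡ-+ (ℕtoℚ p) s t ⟨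
    ℕtoℚ p * (s + t)             ∎)
    where open ≡-Reasoning

  *-congˡ : ∀ {a b c} → Integral c → a ≈ b → c * a ≈ c * b
  *-congˡ {a} {b} {c} c-int (congruent s s-int e) = congruent (c * s) (*-integral c-int s-int) (begin
    c * a - c * b                ≡⟨ ((∀ a b c → c * a - c * b ≡ c * (a - b)) ∋ solve-∀ ring) a b c ⟩
    c * (a - b)                  ≡⟨ cong (c *_) e ⟩
    c * (ℕtoℚ p * s)             ≡⟨ ((∀ c q s → c * (q * s) ≡ q * (c * s)) ∋ solve-∀ ring) c (ℕtoℚ p) s ⟩
    ℕtoℚ p * (c * s)             ∎)
    where open ≡-Reasoning

  *-congʳ : ∀ {a b c} → Integral c → a ≈ b → a * c ≈ b * c
  *-congʳ {a} {b} {c} c-int a≈b = subst₂ _≈_ (ℚP.*-comm c a) (ℚP.*-comm c b) (*-congˡ c-int a≈b)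

  -- From a c - b d = (a - b) c + b (c - d), which needs only b and c to be integral.
  *-cong : ∀ {a b c d} → Integral b → Integral c → a ≈ b → c ≈ d → a * c ≈ b * d
  *-cong b-int c-int a≈b c≈d = ≈-trans (*-congʳ c-int a≈b) (*-congˡ b-int c≈d)

  neg-cong : ∀ {a b} → a ≈ b → - a ≈ - b
  neg-cong {a} {b} a≈b = subst₂ _≈_ (neg a) (neg b) (*-congˡ (neg-integral (ℕ-integral 1)) a≈b)
    where
    neg : ∀ a → - 1ℚ * a ≡ - a
    neg = solve-∀ ring

  sub-cong : ∀ {a b c d} → a ≈ b → c ≈ d → a - c ≈ b - d
  sub-cong a≈b c≈d = +-cong a≈b (neg-cong c≈d)

  pow-cong : ∀ {a b} → Integral b → a ≈ b → ∀ n → powℚ a n ≈ powℚ b n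
  pow-cong b-int a≈b zero    = ≈-refl
  pow-cong b-int a≈b (suc n) = *-cong b-int (pow-integral (≈-integral a≈b b-int) n) a≈b (pow-cong b-int a≈b n)

  Σ-≈0 : ∀ n f → (∀ i → i < n → f i ≈ 0ℚ) → Σℚ< n f ≈ 0ℚ
  Σ-≈0 = Σ-induction (_≈ 0ℚ) ≈-refl +-cong

  Σ-≈-cong : ∀ n {f g} → (∀ i → i < n → f i ≈ g i) → Σℚ< n f ≈ Σℚ< n g
  Σ-≈-cong zero    h = ≈-refl
  Σ-≈-cong (suc n) {f} {g} h = subst₂ _≈_ (sym (Σ-last n f)) (sym (Σ-last n g))
    (+-cong (Σ-≈-cong n (λ i i<n → h i (ℕP.m<n⇒m<1+n i<n))) (h n (ℕP.n<1+n n)))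

  cancel-≈ : ∀ {n a b} → p ∤ n → ℕtoℚ n * a ≈ ℕtoℚ n * b → a ≈ b
  cancel-≈ {n} {a} {b} p∤n na≈nb = subst₂ _≈_ (recip-* n {{∤⇒NonZero p∤n}} a) (recip-* n {{∤⇒NonZero p∤n}} b)
    (*-congˡ (recipℕ-integral p∤n) na≈nb)

  p*≈0 : ∀ {a} → Integral a → ℕtoℚ p * a ≈ 0ℚ
  p*≈0 {a} a-int = congruent a a-int (((∀ a → a - 0ℚ ≡ a) ∋ solve-∀ ring) (ℕtoℚ p * a))

  p≈0 : ℕtoℚ p ≈ 0ℚ
  p≈0 = subst (_≈ 0ℚ) (ℚP.*-identityʳ (ℕtoℚ p)) (p*≈0 (ℕ-integral 1))

  -- The quotient stored in a congruence to 0 is a/p itself. This is how the Wilson and Fermat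
  -- quotients are seen to be p-integral.
  ≈0-quotient : ∀ {a} → a ≈ 0ℚ → Integral (a * recipℕ p)
  ≈0-quotient {a} (congruent s s-int e) = subst Integral (begin
    s                                ≡⟨ recip-* p s ⟨
    recipℕ p * (ℕtoℚ p * s)          ≡⟨ cong (recipℕ p *_) e ⟨
    recipℕ p * (a - 0ℚ)              ≡⟨ ((∀ r a → r * (a - 0ℚ) ≡ a * r) ∋ solve-∀ ring) (recipℕ p) a ⟩
    a * recipℕ p                     ∎) s-int
    where open ≡-Reasoning

  -- Clearing the denominator d of the quotient leaves (a - b) d = n p with p prime to d, and
  -- Euclid's lemma applies. This leads back to the divisibility that defines equality in 𝒜.
  ≈⇒∣ : ∀ a b → ℤtoℚ a ≈ ℤtoℚ b → (ℤ.+ p) ℤD.∣ (a ℤ.- b)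
  ≈⇒∣ a b (congruent s (integral d n p∤d sd≡n) e) = [ id , (λ p∣d → contradiction p∣d p∤d) ]′
    (euclidsLemma ℤ.∣ a ℤ.- b ∣ d p-prime (subst (p ∣_) (trans (sym (ℤP.abs-* n (ℤ.+ p))) (trans (cong ℤ.∣_∣ (sym [a-b]d≡np)) (ℤP.abs-* (a ℤ.- b) (ℤ.+ d)))) (ℕD.n∣m*n ℤ.∣ n ∣)))
    where
    open ≡-Reasoning
    [a-b]d≡np : (a ℤ.- b) ℤ.* ℤ.+ d ≡ n ℤ.* ℤ.+ p
    [a-b]d≡np = ℤtoℚ-injective _ _ (begin
      ℤtoℚ ((a ℤ.- b) ℤ.* ℤ.+ d)      ≡⟨ ℤtoℚ-* (a ℤ.- b) (ℤ.+ d) ⟩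
      ℤtoℚ (a ℤ.- b) * ℕtoℚ d         ≡⟨ cong (_* ℕtoℚ d) (trans (ℤtoℚ-+ a (ℤ.- b)) (cong (ℤtoℚ a +_) (ℤtoℚ-neg b))) ⟩
      (ℤtoℚ a - ℤtoℚ b) * ℕtoℚ d      ≡⟨ cong (_* ℕtoℚ d) e ⟩
      ℕtoℚ p * s * ℕtoℚ d             ≡⟨ ((∀ q s d → q * s * d ≡ s * d * q) ∋ solve-∀ ring) (ℕtoℚ p) s (ℕtoℚ d) ⟩
      s * ℕtoℚ d * ℕtoℚ p             ≡⟨ cong (_* ℕtoℚ p) sd≡n ⟩
      ℤtoℚ n * ℕtoℚ p                 ≡⟨ ℤtoℚ-* n (ℤ.+ p) ⟨
      ℤtoℚ (n ℤ.* ℤ.+ p)              ∎)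

  -- In (k+1) binom(p,k+1) = (p-k) binom(p,k) the right side is p for k = 0 and vanishes mod p
  -- inductively afterwards, while k+1 is a unit.
  binom-p≈0 : ∀ {k} → suc k < p → binomℚ (ℕtoℚ p) (suc k) ≈ 0ℚ
  binom-p≈0 {k} 1+k<p = cancel-≈ (<⇒∤ 1+k<p) (begin
    ℕtoℚ (suc k) * binomℚ (ℕtoℚ p) (suc k)       ≡⟨ binomℚ-suc (ℕtoℚ p) k ⟩
    (ℕtoℚ p - ℕtoℚ k) * binomℚ (ℕtoℚ p) k        ≈⟨ vanish k 1+k<p ⟩
    0ℚ                                           ≡⟨ ℚP.*-zeroʳ (ℕtoℚ (suc k)) ⟨
    ℕtoℚ (suc k) * 0ℚ                            ∎)
    where
    open ≈-Reasoning
    vanish : ∀ k → suc k < p → (ℕtoℚ p - ℕtoℚ k) * binomℚ (ℕtoℚ p) k ≈ 0ℚ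
    vanish zero    _ = ≈-trans (≡⇒≈ (((∀ q → (q - 0ℚ) * 1ℚ ≡ q) ∋ solve-∀ ring) (ℕtoℚ p))) p≈0
    vanish (suc j) h = ≈-trans (*-congˡ (sub-integral (ℕ-integral p) (ℕ-integral (suc j))) (binom-p≈0 (ℕP.<-trans (ℕP.n<1+n (suc j)) h)))
      (≡⇒≈ (ℚP.*-zeroʳ (ℕtoℚ p - ℕtoℚ (suc j))))

  fermat-ℕ : ∀ a → powℚ (ℕtoℚ a) p ≈ ℕtoℚ a
  fermat-ℕ = go p refl
    where
    go : ∀ q → q ≡ p → ∀ a → powℚ (ℕtoℚ a) q ≈ ℕtoℚ a
    go zero    refl a       = contradiction refl (ℕ.≢-nonZero⁻¹ p)
    go (suc q) refl zero    = ≡⇒≈ (ℚP.*-zeroˡ (powℚ 0ℚ q))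
    go (suc q) refl (suc a) = begin
      powℚ (ℕtoℚ (suc a)) p
        ≡⟨ cong (λ s → powℚ s p) (trans (ℕtoℚ-suc a) (ℚP.+-comm 1ℚ (ℕtoℚ a))) ⟩
      powℚ (ℕtoℚ a + 1ℚ) p
        ≡⟨ binomial-theorem (ℕtoℚ a) p ⟩
      Σℚ< (suc p) f
        ≡⟨ trans (Σ-last p f) (cong₂ _+_ (Σ-first q f) (trans (cong (_* powℚ (ℕtoℚ a) p) (binomℚ-ℕ-≡ p)) (ℚP.*-identityˡ _))) ⟩
      1ℚ + Σℚ< q (f ∘ suc) + powℚ (ℕtoℚ a) p
        ≈⟨ +-cong (+-cong (≈-refl {1ℚ}) (Σ-≈0 q (f ∘ suc) (λ i i<q →
             ≈-trans (*-congʳ (pow-integral (ℕ-integral a) (suc i)) (binom-p≈0 (s≤s i<q))) (≡⇒≈ (ℚP.*-zeroˡ (powℚ (ℕtoℚ a) (suc i)))))))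
           (go (suc q) refl a) ⟩
      1ℚ + ℕtoℚ a
        ≡⟨ ℕtoℚ-suc a ⟨
      ℕtoℚ (suc a) ∎
      where
      open ≈-Reasoning
      f = λ k → binomℚ (ℕtoℚ p) k * powℚ (ℕtoℚ a) k

  -- Uses -1 ≡ p - 1, so that Fermat's theorem passes from ℕ to ℤ without the parity of p.
  ℤ≈ℕ : ∀ z → ∃ λ n → ℤtoℚ z ≈ ℕtoℚ n
  ℤ≈ℕ (ℤ.+ n)      = n , ≈-refl
  ℤ≈ℕ ℤ.-[1+ n ]   = suc n ℕ.* (p ∸ 1) , (begin
    ℤtoℚ ℤ.-[1+ n ]                           ≡⟨ ℤtoℚ-neg (ℤ.+ suc n) ⟩
    - ℕtoℚ (suc n)                            ≡⟨ ((∀ a → - a ≡ 0ℚ - a) ∋ solve-∀ ring) (ℕtoℚ (suc n)) ⟩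
    0ℚ - ℕtoℚ (suc n)                         ≈⟨ sub-cong (p*≈0 (ℕ-integral (suc n))) (≈-refl {ℕtoℚ (suc n)}) ⟨
    ℕtoℚ p * ℕtoℚ (suc n) - ℕtoℚ (suc n)      ≡⟨ cong (λ s → s * ℕtoℚ (suc n) - ℕtoℚ (suc n)) (trans (cong ℕtoℚ (sym (ℕP.m+[n∸m]≡n (ℕ.>-nonZero⁻¹ p)))) (ℕtoℚ-suc (p ∸ 1))) ⟩
    (1ℚ + ℕtoℚ (p ∸ 1)) * ℕtoℚ (suc n) - ℕtoℚ (suc n)  ≡⟨ ((∀ a b → (1ℚ + a) * b - b ≡ b * a) ∋ solve-∀ ring) (ℕtoℚ (p ∸ 1)) (ℕtoℚ (suc n)) ⟩
    ℕtoℚ (suc n) * ℕtoℚ (p ∸ 1)               ≡⟨ ℕtoℚ-* (suc n) (p ∸ 1) ⟨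
    ℕtoℚ (suc n ℕ.* (p ∸ 1))                  ∎)
    where open ≈-Reasoning

  fermat-ℤ : ∀ z → powℚ (ℤtoℚ z) p ≈ ℤtoℚ z
  fermat-ℤ z with ℤ≈ℕ z
  ... | n , z≈n = ≈-trans (pow-cong (ℕ-integral n) z≈n p) (≈-trans (fermat-ℕ n) (≈-sym z≈n))

  -- For x = n/d, Fermat for the integers n and d gives d x^p ≡ (d x)^p = n^p ≡ n = d x, and d
  -- cancels.
  fermat : ∀ {x} → Integral x → powℚ x p ≈ x
  fermat {x} x-int@(integral d n p∤d xd≡n) = cancel-≈ p∤d (begin
    ℕtoℚ d * powℚ x p              ≈⟨ *-congʳ (pow-integral x-int p) (fermat-ℕ d) ⟨
    powℚ (ℕtoℚ d) p * powℚ x p     ≡⟨ powℚ-* (ℕtoℚ d) x p ⟨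
    powℚ (ℕtoℚ d * x) p            ≡⟨ cong (λ a → powℚ a p) dx≡n ⟩
    powℚ (ℤtoℚ n) p                ≈⟨ fermat-ℤ n ⟩
    ℤtoℚ n                         ≡⟨ dx≡n ⟨
    ℕtoℚ d * x                     ∎)
    where
    open ≈-Reasoning
    dx≡n : ℕtoℚ d * x ≡ ℤtoℚ n
    dx≡n = trans (ℚP.*-comm (ℕtoℚ d) x) xd≡n

  fermat-unit : ∀ {n} → p ∤ n → powℚ (ℕtoℚ n) (p ∸ 1) ≈ 1ℚ
  fermat-unit {n} p∤n = cancel-≈ p∤n (begin
    ℕtoℚ n * powℚ (ℕtoℚ n) (p ∸ 1)      ≡⟨ cong (powℚ (ℕtoℚ n)) (ℕP.m+[n∸m]≡n (ℕ.>-nonZero⁻¹ p)) ⟩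
    powℚ (ℕtoℚ n) p                     ≈⟨ fermat-ℕ n ⟩
    ℕtoℚ n                              ≡⟨ ℚP.*-identityʳ (ℕtoℚ n) ⟨
    ℕtoℚ n * 1ℚ                         ∎)
    where open ≈-Reasoning

  -- By Fermat, d^(p-2) is an inverse of d mod p.
  redℚ-≈ : ∀ {q} → Integral q → ℤtoℚ (redℚ p q) ≈ q
  redℚ-≈ {q} q-int with p ∣? ℚ.denominatorℕ q
  ... | yes p∣d = contradiction p∣d (integral⇒∤denominator q-int)
  ... | no  p∤d = begin
    ℤtoℚ (↥ q ℤ.* (ℤ.+ d) ℤ.^ (p ∸ 2))           ≡⟨ ℤtoℚ-* (↥ q) ((ℤ.+ d) ℤ.^ (p ∸ 2)) ⟩
    ℤtoℚ (↥ q) * ℤtoℚ ((ℤ.+ d) ℤ.^ (p ∸ 2))      ≡⟨ cong₂ _*_ (sym (↥≡*↧ q)) (ℤtoℚ-^ (ℤ.+ d) (p ∸ 2)) ⟩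
    q * ℕtoℚ d * powℚ (ℕtoℚ d) (p ∸ 2)           ≡⟨ ℚP.*-assoc q (ℕtoℚ d) (powℚ (ℕtoℚ d) (p ∸ 2)) ⟩
    q * powℚ (ℕtoℚ d) (suc (p ∸ 2))              ≡⟨ cong (λ n → q * powℚ (ℕtoℚ d) n) (ℕP.+-∸-assoc 1 (ℕ.nonTrivial⇒n>1 p {{prime⇒nonTrivial p-prime}})) ⟨
    q * powℚ (ℕtoℚ d) (p ∸ 1)                    ≈⟨ *-congˡ q-int (fermat-unit p∤d) ⟩
    q * 1ℚ                                       ≡⟨ ℚP.*-identityʳ q ⟩
    q                                            ∎
    where
    open ≈-Reasoning
    d = ℚ.denominatorℕ q

-- The sums of the theorem modulo p

Σ-truncate : ∀ {m n} f → m ≤ n → (∀ i → m ≤ i → f i ≡ 0ℚ) → Σℚ< n f ≡ Σℚ< m f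
Σ-truncate {m} f m≤n f≡0 = go (ℕP.≤⇒≤′ m≤n)
  where
  go : ∀ {n} → m ℕ.≤′ n → Σℚ< n f ≡ Σℚ< m f
  go ℕ.≤′-refl              = refl
  go (ℕ.≤′-step {n} m≤′n) = trans (Σ-last n f)
    (trans (cong₂ _+_ (go m≤′n) (f≡0 n (ℕP.≤′⇒≤ m≤′n))) (ℚP.+-identityʳ (Σℚ< m f)))

-- A m ℓ (x + 1) is the sum over j in the theorem.
A : ℕ → (ℚ → ℚ) → ℚ → ℚ
A m f y = Σℚ< m (λ j → signℚ (m ∸ j) * ℕtoℚ (m C j) * recipℕ (m ∸ j) * f (y + ℕtoℚ j))

-- The split is binom(m+1,j+1)/(m-j) = binom(m,j)/(m-j) + binom(m+1,j+1)/(m+1), proved in `weight`.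
-- The first part gives the sum of order m at y+1. The second, joined by the term j = 0, is 1/(m+1)
-- times the expansion of the difference of order m+1 without its last term f(y+m+1).
A-suc : ∀ m f y → A (suc m) f y ≡ A m f (y + 1ℚ) + recipℕ (suc m) * (Δ^ (suc m) f y - f (y + ℕtoℚ (suc m)))
A-suc m f y = begin
  Σℚ< (suc m) t
    ≡⟨ Σ-first m t ⟩
  t 0 + Σℚ< m (t ∘ suc)
    ≡⟨ cong₂ _+_ first-term (Σ-cong m (λ j j<m → next-term j j<m)) ⟩
  ρ * s * b 0 + Σℚ< m (λ j → t′ j + ρ * s * b (suc j))
    ≡⟨ cong (ρ * s * b 0 +_) (trans (Σ-+ m t′ (λ j → ρ * s * b (suc j))) (cong (Σℚ< m t′ +_) (Σ-*ˡ m (ρ * s) (b ∘ suc)))) ⟩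
  ρ * s * b 0 + (Σℚ< m t′ + ρ * s * Σℚ< m (b ∘ suc))
    ≡⟨ ((∀ ρ s b a c → ρ * s * b + (a + ρ * s * c) ≡ a + ρ * (s * (b + c))) ∋ solve-∀ ring) ρ s (b 0) (Σℚ< m t′) (Σℚ< m (b ∘ suc)) ⟩
  Σℚ< m t′ + ρ * (s * (b 0 + Σℚ< m (b ∘ suc)))
    ≡⟨ cong (λ a → Σℚ< m t′ + ρ * (s * a)) (Σ-first m b) ⟨
  Σℚ< m t′ + ρ * (s * Σℚ< (suc m) b)
    ≡⟨ cong (λ a → Σℚ< m t′ + ρ * a) difference ⟨
  A m f (y + 1ℚ) + ρ * (Δ^ (suc m) f y - f (y + ℕtoℚ (suc m))) ∎
  where
  open ≡-Reasoning
  ρ = recipℕ (suc m)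
  s = signℚ (suc m)
  t t′ b : ℕ → ℚ
  t  j = signℚ (suc m ∸ j) * ℕtoℚ (suc m C j) * recipℕ (suc m ∸ j) * f (y + ℕtoℚ j)
  t′ j = signℚ (m ∸ j) * ℕtoℚ (m C j) * recipℕ (m ∸ j) * f (y + 1ℚ + ℕtoℚ j)
  b  j = binomℚ (ℕtoℚ (suc m)) j * (signℚ j * f (y + ℕtoℚ j))

  first-term : t 0 ≡ ρ * s * b 0
  first-term = trans
    (cong (λ c → s * c * ρ * f (y + 0ℚ)) (C≡binomℚ (suc m) 0))
    (((∀ s ρ f → s * 1ℚ * ρ * f ≡ ρ * s * (1ℚ * (1ℚ * f))) ∋ solve-∀ ring) s ρ (f (y + 0ℚ)))

  weight : ∀ j → j < m → binomℚ (ℕtoℚ (suc m)) (suc j) * recipℕ (m ∸ j) ≡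
           binomℚ (ℕtoℚ m) j * recipℕ (m ∸ j) + ρ * binomℚ (ℕtoℚ (suc m)) (suc j)
  weight j j<m = begin
    X * σ                    ≡⟨ cong (_* σ) (binomℚ-ℕ-suc m j) ⟩
    (Z + Y) * σ              ≡⟨ ((∀ z y σ → (z + y) * σ ≡ y * σ + σ * (1ℚ * z)) ∋ solve-∀ ring) Z Y σ ⟩
    Y * σ + σ * (1ℚ * Z)     ≡⟨ cong (λ a → Y * σ + σ * (a * Z)) (*-recipℕ (suc m)) ⟨
    Y * σ + σ * (M * ρ * Z)  ≡⟨ ((∀ y σ m ρ z → y * σ + σ * (m * ρ * z) ≡ y * σ + ρ * (σ * (m * z))) ∋ solve-∀ ring) Y σ M ρ Z ⟩
    Y * σ + ρ * (σ * (M * Z))  ≡⟨ cong (λ a → Y * σ + ρ * (σ * a)) MZ≡dX ⟩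
    Y * σ + ρ * (σ * (ℕtoℚ (m ∸ j) * X))  ≡⟨ cong (λ a → Y * σ + ρ * a) (recip-* (m ∸ j) {{ℕ.>-nonZero (ℕP.m<n⇒0<n∸m j<m)}} X) ⟩
    Y * σ + ρ * X            ∎
    where
    M = ℕtoℚ (suc m)
    X = binomℚ (ℕtoℚ (suc m)) (suc j)
    Y = binomℚ (ℕtoℚ m) j
    Z = binomℚ (ℕtoℚ m) (suc j)
    σ = recipℕ (m ∸ j)
    sm≡m+1 : ℕtoℚ (suc m) ≡ ℕtoℚ m + 1ℚ
    sm≡m+1 = trans (ℕtoℚ-suc m) (ℚP.+-comm 1ℚ (ℕtoℚ m))
    -- Absorption: (m+1) binom(m,j+1) = (m-j) binom(m+1,j+1), which lets the factor m-j cancel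
    -- against `σ`.
    MZ≡dX : M * Z ≡ ℕtoℚ (m ∸ j) * X
    MZ≡dX = begin
      M * Z                                                          ≡⟨ cong (_* Z) sm≡m+1 ⟩
      (ℕtoℚ m + 1ℚ) * Z                                              ≡⟨ binomℚ-absorption (ℕtoℚ m) (suc j) ⟨
      (ℕtoℚ m + 1ℚ - ℕtoℚ (suc j)) * binomℚ (ℕtoℚ m + 1ℚ) (suc j)    ≡⟨ cong₂ (λ a c → (a - ℕtoℚ (suc j)) * binomℚ c (suc j)) (sym sm≡m+1) (sym sm≡m+1) ⟩
      (M - ℕtoℚ (suc j)) * X                                         ≡⟨ cong (_* X) (cong₂ _-_ (trans (cong (λ n → ℕtoℚ (suc n)) (sym (ℕP.m+[n∸m]≡n (ℕP.<⇒≤ j<m)))) (ℕtoℚ-+ (suc j) (m ∸ j))) refl) ⟩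
      (ℕtoℚ (suc j) + ℕtoℚ (m ∸ j) - ℕtoℚ (suc j)) * X               ≡⟨ ((∀ a b x → (a + b - a) * x ≡ b * x) ∋ solve-∀ ring) (ℕtoℚ (suc j)) (ℕtoℚ (m ∸ j)) X ⟩
      ℕtoℚ (m ∸ j) * X                                               ∎

  next-term : ∀ j → j < m → t (suc j) ≡ t′ j + ρ * s * b (suc j)
  next-term j j<m = begin
    signℚ (m ∸ j) * ℕtoℚ (suc m C suc j) * σ * F
      ≡⟨ cong₂ (λ a c → a * c * σ * F) (sign-∸ (ℕP.<⇒≤ j<m)) (C≡binomℚ (suc m) (suc j)) ⟩
    signℚ m * signℚ j * X * σ * F
      ≡⟨ ((∀ a b x σ f → a * b * x * σ * f ≡ a * b * f * (x * σ)) ∋ solve-∀ ring) (signℚ m) (signℚ j) X σ F ⟩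
    signℚ m * signℚ j * F * (X * σ)
      ≡⟨ cong (signℚ m * signℚ j * F *_) (weight j j<m) ⟩
    signℚ m * signℚ j * F * (Y * σ + ρ * X)
      ≡⟨ ((∀ a b f y σ ρ x → a * b * f * (y * σ + ρ * x) ≡ a * b * y * σ * f + ρ * (- a) * (x * (- b * f))) ∋ solve-∀ ring) (signℚ m) (signℚ j) F Y σ ρ X ⟩
    signℚ m * signℚ j * Y * σ * F + ρ * s * b (suc j)
      ≡⟨ cong (_+ ρ * s * b (suc j)) (trans
           (cong₂ (λ a c → a * c * σ * F) (sym (sign-∸ (ℕP.<⇒≤ j<m))) (sym (C≡binomℚ m j)))
           (cong (λ z → signℚ (m ∸ j) * ℕtoℚ (m C j) * σ * f z) (sym (+-ℕtoℚ-suc y j)))) ⟩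
    t′ j + ρ * s * b (suc j) ∎
    where
    σ = recipℕ (m ∸ j)
    F = f (y + ℕtoℚ (suc j))
    X = binomℚ (ℕtoℚ (suc m)) (suc j)
    Y = binomℚ (ℕtoℚ m) j

  difference : Δ^ (suc m) f y - f (y + ℕtoℚ (suc m)) ≡ s * Σℚ< (suc m) b
  difference = begin
    Δ^ (suc m) f y - F                              ≡⟨ cong (_- F) (Δ^-expansion (suc m) f y) ⟩
    s * Σℚ< (suc (suc m)) b - F                     ≡⟨ cong (λ a → s * a - F) (Σ-last (suc m) b) ⟩
    s * (Σℚ< (suc m) b + b (suc m)) - F             ≡⟨ cong (λ c → s * (Σℚ< (suc m) b + c * (s * F)) - F) (binomℚ-ℕ-≡ (suc m)) ⟩
    s * (Σℚ< (suc m) b + 1ℚ * (s * F)) - F          ≡⟨ ((∀ s a f → s * (a + 1ℚ * (s * f)) - f ≡ s * a + (s * s) * f - f) ∋ solve-∀ ring) s (Σℚ< (suc m) b) F ⟩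
    s * Σℚ< (suc m) b + (s * s) * F - F             ≡⟨ cong (λ a → s * Σℚ< (suc m) b + a * F - F) (sign² (suc m)) ⟩
    s * Σℚ< (suc m) b + 1ℚ * F - F                  ≡⟨ ((∀ a f → a + 1ℚ * f - f ≡ a) ∋ solve-∀ ring) (s * Σℚ< (suc m) b) F ⟩
    s * Σℚ< (suc m) b                               ∎
    where F = f (y + ℕtoℚ (suc m))

rising-suc : ∀ n k → rising n (suc k) ≡ n ℕ.* rising (suc n) k
rising-suc n zero    = trans (ℕP.*-identityˡ (n ℕ.+ 0)) (trans (ℕP.+-identityʳ n) (sym (ℕP.*-identityʳ n)))
rising-suc n (suc k) = begin
  rising n (suc k) ℕ.* (n ℕ.+ suc k)           ≡⟨ cong₂ ℕ._*_ (rising-suc n k) (ℕP.+-suc n k) ⟩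
  n ℕ.* rising (suc n) k ℕ.* (suc n ℕ.+ k)     ≡⟨ ℕP.*-assoc n (rising (suc n) k) (suc n ℕ.+ k) ⟩
  n ℕ.* rising (suc n) (suc k)                 ∎
  where open ≡-Reasoning

rising≢0 : ∀ n k → NonZero (rising (suc n) k)
rising≢0 n zero    = _
rising≢0 n (suc k) = ℕP.m*n≢0 (rising (suc n) k) (suc n ℕ.+ k) {{rising≢0 n k}}

-- The beta integral B(i+1, m+1).
β : ℕ → ℕ → ℚ
β m i = ℕtoℚ (m !) * recipℕ (rising (suc i) (suc m))

-- In the integral of t^i (1-t)^m over [0,1], one more factor 1-t subtracts the same integral with
-- t^(i+1). In the arithmetic proof, m+1 = (i+m+2) - (i+1), and each of these two numbers is an end
-- factor of `R₂`.
β-suc : ∀ m i → β (suc m) i ≡ β m i - β m (suc i)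
β-suc m i = begin
  ℕtoℚ (suc m ℕ.* m !) * recipℕ R₂
    ≡⟨ cong (_* recipℕ R₂) (ℕtoℚ-* (suc m) (m !)) ⟩
  ℕtoℚ (suc m) * ℕtoℚ (m !) * recipℕ R₂
    ≡⟨ ((∀ n k f r → k * f * r ≡ f * ((n + k) * r) - f * (n * r)) ∋ solve-∀ ring) (ℕtoℚ (suc i)) (ℕtoℚ (suc m)) (ℕtoℚ (m !)) (recipℕ R₂) ⟩
  ℕtoℚ (m !) * ((ℕtoℚ (suc i) + ℕtoℚ (suc m)) * recipℕ R₂) - ℕtoℚ (m !) * (ℕtoℚ (suc i) * recipℕ R₂)
    ≡⟨ cong₂ (λ a b → ℕtoℚ (m !) * a - ℕtoℚ (m !) * b)
         (trans (cong (_* recipℕ R₂) (sym (ℕtoℚ-+ (suc i) (suc m)))) (partial (suc i ℕ.+ suc m) R (ℕP.*-comm R (suc i ℕ.+ suc m))))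
         (partial (suc i) R′ (rising-suc (suc i) (suc m))) ⟩
  β m i - β m (suc i) ∎
  where
  open ≡-Reasoning
  R R′ R₂ : ℕ
  R  = rising (suc i) (suc m)
  R′ = rising (suc (suc i)) (suc m)
  R₂ = rising (suc i) (suc (suc m))
  instance
    R≢0 : NonZero R
    R≢0 = rising≢0 i (suc m)
    R′≢0 : NonZero R′
    R′≢0 = rising≢0 (suc i) (suc m)
  partial : ∀ a b .{{_ : NonZero a}} .{{_ : NonZero b}} → R₂ ≡ a ℕ.* b → ℕtoℚ a * recipℕ R₂ ≡ recipℕ b
  partial a b e = begin
    ℕtoℚ a * recipℕ R₂                  ≡⟨ cong (λ c → ℕtoℚ a * recipℕ c) e ⟩
    ℕtoℚ a * recipℕ (a ℕ.* b)           ≡⟨ cong (ℕtoℚ a *_) (recipℕ-* a b) ⟩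
    ℕtoℚ a * (recipℕ a * recipℕ b)      ≡⟨ ℚP.*-assoc (ℕtoℚ a) (recipℕ a) (recipℕ b) ⟨
    ℕtoℚ a * recipℕ a * recipℕ b        ≡⟨ cong (_* recipℕ b) (*-recipℕ a) ⟩
    1ℚ * recipℕ b                       ≡⟨ ℚP.*-identityˡ (recipℕ b) ⟩
    recipℕ b                            ∎

β-zeroˡ : ∀ i → β 0 i ≡ recipℕ (suc i)
β-zeroˡ i = trans (ℚP.*-identityˡ (recipℕ (rising (suc i) 1))) (cong recipℕ (trans (ℕP.*-identityˡ (suc i ℕ.+ 0)) (ℕP.+-identityʳ (suc i))))

rising-1 : ∀ k → rising 1 k ≡ k !
rising-1 zero    = refl
rising-1 (suc k) = trans (cong (ℕ._* suc k) (rising-1 k)) (ℕP.*-comm (k !) (suc k))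

β-zeroʳ : ∀ m → β m 0 ≡ recipℕ (suc m)
β-zeroʳ m = begin
  ℕtoℚ (m !) * recipℕ (rising 1 (suc m))            ≡⟨ cong (λ a → ℕtoℚ (m !) * recipℕ a) (rising-1 (suc m)) ⟩
  ℕtoℚ (m !) * recipℕ (suc m ℕ.* m !)               ≡⟨ cong (ℕtoℚ (m !) *_) (recipℕ-* (suc m) (m !)) ⟩
  ℕtoℚ (m !) * (recipℕ (suc m) * recipℕ (m !))      ≡⟨ ((∀ f r s → f * (r * s) ≡ f * s * r) ∋ solve-∀ ring) (ℕtoℚ (m !)) (recipℕ (suc m)) (recipℕ (m !)) ⟩
  ℕtoℚ (m !) * recipℕ (m !) * recipℕ (suc m)        ≡⟨ cong (_* recipℕ (suc m)) (*-recipℕ (m !)) ⟩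
  1ℚ * recipℕ (suc m)                               ≡⟨ ℚP.*-identityˡ (recipℕ (suc m)) ⟩
  recipℕ (suc m)                                    ∎
  where
  open ≡-Reasoning
  instance
    m!≢0 : NonZero (m !)
    m!≢0 = m ℕP.!≢0

-- T m N x is the sum defining γ^{K,m}(x), cut off after N terms.
T : ℕ → ℕ → ℚ → ℚ
T m N x = Σℚ< N (λ i → signℚ i * β m i * G (suc i) x)

-- `G-suc` creates the neighbour sums, and summation by parts turns the weights into differences of
-- `β`. The lower boundary term is `β m 0` times G_0 = 1; the upper one remains to be evaluated mod
-- p.
T-suc : ∀ m N x → T m (suc N) (x + 1ℚ) ≡ recipℕ (suc m) + T (suc m) N x + signℚ N * β m N * G (suc N) x
T-suc m N x = begin
  Σℚ< (suc N) (λ i → c i * G (suc i) (x + 1ℚ))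
    ≡⟨ Σ-cong (suc N) (λ i _ → cong (c i *_) (G-suc i x)) ⟩
  Σℚ< (suc N) (λ i → c i * (G (suc i) x + G i x))
    ≡⟨ summation-by-parts N c (λ i → G i x) ⟩
  1ℚ * β m 0 * 1ℚ + Σℚ< N (λ i → (c i + c (suc i)) * G (suc i) x) + c N * G (suc N) x
    ≡⟨ cong₂ (λ a b → a + b + c N * G (suc N) x)
         (trans (((∀ a → 1ℚ * a * 1ℚ ≡ a) ∋ solve-∀ ring) (β m 0)) (β-zeroʳ m))
         (Σ-cong N (λ i _ → cong (_* G (suc i) x) (combine i))) ⟩
  recipℕ (suc m) + T (suc m) N x + c N * G (suc N) x ∎
  where
  open ≡-Reasoning
  c : ℕ → ℚ
  c i = signℚ i * β m i
  combine : ∀ i → c i + c (suc i) ≡ signℚ i * β (suc m) i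
  combine i = trans (((∀ s a b → s * a + - s * b ≡ s * (a - b)) ∋ solve-∀ ring) (signℚ i) (β m i) (β m (suc i)))
    (cong (signℚ i *_) (sym (β-suc m i)))

-- Gregory polynomials modulo an odd prime p = r + 2

module Congruences {r : ℕ} (p-prime : Prime (suc (suc r))) (0<r : 0 < r) where

  open Localization p-prime

  p q : ℕ
  p = suc (suc r)
  q = suc r

  1/p w : ℚ
  1/p = recipℕ p
  w   = ℕtoℚ (q ! ℕ.+ 1) * 1/p

  -- The Fermat quotient, multiplied by y.
  ℓ : ℚ → ℚ
  ℓ y = (powℚ y p - y) * 1/p

  sign-q : signℚ q ≡ 1ℚ
  sign-q with p % 2 in e | m≡m%n+[m/n]*n p 2 | m%n<n p 2
  ... | 0 | _ | _ = contradiction (prime⇒irreducible p-prime (ℕD.m%n≡0⇒n∣m p 2 e))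
    [ (λ ()) , (λ 2≡p → ℕP.<⇒≢ 0<r (ℕP.suc-injective (ℕP.suc-injective 2≡p))) ]′
  ... | 1 | p≡1+2k | _ = trans (cong signℚ (ℕP.suc-injective p≡1+2k)) (sign-even (p ℕ./ 2))
  ... | suc (suc _) | _ | s≤s (s≤s ())

  -- By Fermat, φ q (1+t)^j = (j+1)^q is 1 mod p for every j < q; these values
  -- determine the weights v q k with 0 < k < q recursively.
  v≈0 : ∀ {k} → k < r → ℕtoℚ (v q (suc k)) ≈ 0ℚ
  v≈0 {k} k<r = go (suc k) (ℕP.n<1+n k) k<r
    where
    go : ∀ m {k} → k < m → k < r → ℕtoℚ (v q (suc k)) ≈ 0ℚ
    step : ∀ m → m < r → ℕtoℚ (v q (suc m)) ≈ 0ℚ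
    go (suc m) k<1+m k<r with ℕP.m≤n⇒m<n∨m≡n (ℕP.≤-pred k<1+m)
    ... | inj₁ k<m  = go m k<m k<r
    ... | inj₂ refl = step m k<r
    step m m<r = begin
      ℕtoℚ (v q (suc m))
        ≡⟨ ((∀ a → a ≡ 1ℚ + 0ℚ + a * 1ℚ - 1ℚ) ∋ solve-∀ ring) (ℕtoℚ (v q (suc m))) ⟩
      1ℚ + 0ℚ + ℕtoℚ (v q (suc m)) * 1ℚ - 1ℚ
        ≈⟨ sub-cong (+-cong (+-cong (≈-refl {1ℚ}) (≈-sym (Σ-≈0 m (g ∘ suc) middle))) ≈-refl) (≈-refl {1ℚ}) ⟩
      1ℚ + Σℚ< m (g ∘ suc) + ℕtoℚ (v q (suc m)) * 1ℚ - 1ℚ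
        ≡⟨ cong (_- 1ℚ) (sym value) ⟩
      powℚ (ℕtoℚ (suc (suc m))) q - 1ℚ
        ≈⟨ sub-cong (fermat-unit (<⇒∤ (s≤s (s≤s m<r)))) (≈-refl {1ℚ}) ⟩
      0ℚ ∎
      where
      open ≈-Reasoning
      j = ℕtoℚ (suc m)
      g = λ k → ℕtoℚ (v q k) * binomℚ j k
      middle : ∀ i → i < m → g (suc i) ≈ 0ℚ
      middle i i<m = ≈-trans
        (*-congʳ (binom-integral {j} {suc i} (ℕ-integral (suc m)) (s≤s (ℕP.<-trans i<m (ℕP.<-trans m<r (ℕP.n<1+n r))))) (go m i<m (ℕP.<-trans i<m m<r)))
        (≡⇒≈ (ℚP.*-zeroˡ (binomℚ j (suc i))))
      -- Test series (1+t)^(m+1): it stops in degree m+1 with leading coefficient 1, so the new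
      -- weight appears once, next to weights already known to vanish mod p.
      value : powℚ (ℕtoℚ (suc (suc m))) q ≡ 1ℚ + Σℚ< m (g ∘ suc) + ℕtoℚ (v q (suc m)) * 1ℚ
      value = trans (cong (λ y → powℚ y q) (trans (ℕtoℚ-suc (suc m)) (ℚP.+-comm 1ℚ j)))
        (trans (sym (φ-binom q j))
        (trans (φ-expansion q (binomSeries j))
        (trans (Σ-truncate g (s≤s (s≤s (ℕP.<⇒≤ m<r)))
          (λ i 1+m<i → trans (cong (ℕtoℚ (v q i) *_) (binomℚ-ℕ-< 1+m<i)) (ℚP.*-zeroʳ (ℕtoℚ (v q i)))))
        (trans (Σ-last (suc m) g)
        (cong₂ _+_ (trans (Σ-first m g) (cong (λ a → ℕtoℚ a * 1ℚ + Σℚ< m (g ∘ suc)) (v-zeroʳ q)))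
          (cong (ℕtoℚ (v q (suc m)) *_) (binomℚ-ℕ-≡ (suc m))))))))

  -- Of the weights `v q k` only those at the ends, 1 and q!, survive mod p. Integrality is asked
  -- just in degrees 1 to q-1, so that F_x qualifies although its coefficient in degree q has p in
  -- the denominator.
  φ-≈ : ∀ f → (∀ i → i < r → Integral (f (suc i))) → φ q f ≈ f 0 + ℕtoℚ (q !) * f q
  φ-≈ f f-int = begin
    φ q f                                        ≡⟨ φ-expansion q f ⟩
    Σℚ< (suc q) g                                ≡⟨ trans (Σ-last q g) (cong (_+ g q) (Σ-first r g)) ⟩
    g 0 + Σℚ< r (g ∘ suc) + g q                  ≈⟨ +-cong (+-cong (≈-refl {g 0}) (Σ-≈0 r (g ∘ suc) middle)) (≈-refl {g q}) ⟩
    g 0 + 0ℚ + g q                               ≡⟨ cong₂ (λ a b → ℕtoℚ a * f 0 + 0ℚ + ℕtoℚ b * f q) (v-zeroʳ q) (v-diagonal q) ⟩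
    1ℚ * f 0 + 0ℚ + ℕtoℚ (q !) * f q             ≡⟨ cong (_+ ℕtoℚ (q !) * f q) (((∀ a → 1ℚ * a + 0ℚ ≡ a) ∋ solve-∀ ring) (f 0)) ⟩
    f 0 + ℕtoℚ (q !) * f q                       ∎
    where
    open ≈-Reasoning
    g = λ k → ℕtoℚ (v q k) * f k
    middle : ∀ i → i < r → g (suc i) ≈ 0ℚ
    middle i i<r = ≈-trans (*-congʳ (f-int i i<r) (v≈0 i<r)) (≡⇒≈ (ℚP.*-zeroˡ (f (suc i))))

  -- `φ-≈` applied to (1+t)^y. It yields both Wilson's theorem and the congruence that makes
  -- binom(y,q) an indicator.
  binom-≈ : ∀ {y} → Integral y → powℚ (y + 1ℚ) q ≈ 1ℚ + ℕtoℚ (q !) * binomℚ y q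
  binom-≈ {y} y-int = subst (_≈ 1ℚ + ℕtoℚ (q !) * binomℚ y q) (φ-binom q y)
    (φ-≈ (binomSeries y) (λ i i<r → binom-integral {y} {suc i} y-int (s≤s (ℕP.<-trans i<r (ℕP.n<1+n r)))))

  -- The case y = q of `binom-≈`: there binom(q,q) = 1, and the power is p^q.
  wilson : ℕtoℚ (q ! ℕ.+ 1) ≈ 0ℚ
  wilson = begin
    ℕtoℚ (q ! ℕ.+ 1)                               ≡⟨ trans (ℕtoℚ-+ (q !) 1) (((∀ a → a + 1ℚ ≡ 1ℚ + a * 1ℚ) ∋ solve-∀ ring) (ℕtoℚ (q !))) ⟩
    1ℚ + ℕtoℚ (q !) * 1ℚ                           ≡⟨ cong (λ a → 1ℚ + ℕtoℚ (q !) * a) (binomℚ-ℕ-≡ q) ⟨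
    1ℚ + ℕtoℚ (q !) * binomℚ (ℕtoℚ q) q            ≈⟨ binom-≈ (ℕ-integral q) ⟨
    powℚ (ℕtoℚ q + 1ℚ) q                           ≡⟨ cong (λ y → powℚ y q) (trans (ℚP.+-comm (ℕtoℚ q) 1ℚ) (sym (ℕtoℚ-suc q))) ⟩
    ℕtoℚ p * powℚ (ℕtoℚ p) r                       ≈⟨ p*≈0 (pow-integral (ℕ-integral p) r) ⟩
    0ℚ                                             ∎
    where open ≈-Reasoning

  w-integral : Integral w
  w-integral = ≈0-quotient wilson

  -- Kept as an exact identity, because q! will multiply `G q x` and the summand p w then meets a
  -- denominator p.
  q!≡pw-1 : ℕtoℚ (q !) ≡ ℕtoℚ p * w - 1ℚ
  q!≡pw-1 = begin
    ℕtoℚ (q !)                                 ≡⟨ ((∀ a → a ≡ 1ℚ * (a + 1ℚ) - 1ℚ) ∋ solve-∀ ring) (ℕtoℚ (q !)) ⟩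
    1ℚ * (ℕtoℚ (q !) + 1ℚ) - 1ℚ                ≡⟨ cong₂ (λ a b → a * b - 1ℚ) (*-recipℕ p) (ℕtoℚ-+ (q !) 1) ⟨
    ℕtoℚ p * 1/p * ℕtoℚ (q ! ℕ.+ 1) - 1ℚ       ≡⟨ ((∀ a b c → a * b * c - 1ℚ ≡ a * (c * b) - 1ℚ) ∋ solve-∀ ring) (ℕtoℚ p) 1/p (ℕtoℚ (q ! ℕ.+ 1)) ⟩
    ℕtoℚ p * w - 1ℚ                            ∎
    where open ≡-Reasoning

  ℓ-integral : ∀ {y} → Integral y → Integral (ℓ y)
  ℓ-integral {y} y-int = ≈0-quotient (≈-trans (sub-cong (fermat y-int) (≈-refl {y})) (≡⇒≈ (ℚP.+-inverseʳ y)))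

  logOver-integral : ∀ k → suc k < p → Integral (logOver k)
  logOver-integral k 1+k<p = *-integral (sign-integral k) (recipℕ-integral (<⇒∤ 1+k<p))

  G-recursion : ∀ n x → G n x ≡ binomℚ x n - Σℚ< n (λ i → logOver (suc i) * G (n ∸ suc i) x)
  G-recursion n x = begin
    G n x                      ≡⟨ ((∀ g s → g ≡ 1ℚ * g + s - s) ∋ solve-∀ ring) (G n x) S ⟩
    1ℚ * G n x + S - S         ≡⟨ cong (_- S) (Σ-first n (λ k → logOver k * G (n ∸ k) x)) ⟨
    (logOver ·S (λ k → G k x)) n - S  ≡⟨ cong (_- S) (log·G x n) ⟩
    binomℚ x n - S             ∎
    where
    open ≡-Reasoning
    S = Σℚ< n (λ i → logOver (suc i) * G (n ∸ suc i) x)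

  -- In `G-recursion` the logarithm contributes denominators up to n+1 and the binomial coefficient
  -- divides n!; all are prime to p as long as n < q.
  G-integral : ∀ {n x} → Integral x → n < q → Integral (G n x)
  G-integral {n} {x} x-int = go (suc n) (ℕP.n<1+n n)
    where
    go : ∀ m {n} → n < m → n < q → Integral (G n x)
    go (suc m) {n} n<1+m n<q = subst Integral (sym (G-recursion n x))
      (sub-integral (binom-integral x-int (ℕP.m<n⇒m<1+n n<q))
        (Σ-integral n (λ i → logOver (suc i) * G (n ∸ suc i) x) (λ i i<n → *-integral (logOver-integral (suc i) (s≤s (ℕP.≤-<-trans i<n n<q)))
          (go m (ℕP.<-≤-trans (n∸1+i<n i i<n) (ℕP.≤-pred n<1+m)) (ℕP.≤-<-trans (ℕP.m∸n≤m n (suc i)) n<q)))))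
      where
      n∸1+i<n : ∀ i → i < n → n ∸ suc i < n
      n∸1+i<n i i<n = ℕP.∸-monoʳ-< {n} {suc i} {0} (s≤s z≤n) i<n

  -- In the recursion for `G q` a single coefficient has p in its denominator: (-1)^q/(q+1) = 1/p,
  -- multiplying G_0 = 1. Adding 1/p removes it.
  G-q+1/p-integral : ∀ {x} → Integral x → Integral (G q x + 1/p)
  G-q+1/p-integral {x} x-int = subst Integral (sym (begin
    G q x + 1/p                                        ≡⟨ cong (_+ 1/p) (G-recursion q x) ⟩
    binomℚ x q - Σℚ< q g + 1/p                         ≡⟨ cong (λ s → binomℚ x q - s + 1/p) (Σ-last r g) ⟩
    binomℚ x q - (Σℚ< r g + g r) + 1/p                 ≡⟨ cong (λ a → binomℚ x q - (Σℚ< r g + a) + 1/p) (cong₂ (λ a b → a * 1/p * b) sign-q (cong (λ n → G n x) (ℕP.n∸n≡0 r))) ⟩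
    binomℚ x q - (Σℚ< r g + 1ℚ * 1/p * 1ℚ) + 1/p       ≡⟨ ((∀ b s r → b - (s + 1ℚ * r * 1ℚ) + r ≡ b - s) ∋ solve-∀ ring) (binomℚ x q) (Σℚ< r g) 1/p ⟩
    binomℚ x q - Σℚ< r g                               ∎))
    (sub-integral (binom-integral x-int (ℕP.n<1+n q))
      (Σ-integral r g (λ i i<r → *-integral (logOver-integral (suc i) (s≤s (s≤s i<r))) (G-integral x-int (s≤s (ℕP.m∸n≤m r i))))))
    where
    open ≡-Reasoning
    g : ℕ → ℚ
    g i = logOver (suc i) * G (q ∸ suc i) x

  -- Compares the exact value of φ q F_x with its value mod p; G q x itself has
  -- p in its denominator.
  G-q-≈ : ∀ {x} → Integral x → G q x + 1/p ≈ 1ℚ - w - Δ^ 1 ℓ (x + 1ℚ)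
  G-q-≈ {x} x-int = begin
    g                                                                 ≡⟨ ((∀ g w d r → g ≡ (d + r) - (1ℚ + (0ℚ - w - g + r)) + (1ℚ - w - d)) ∋ solve-∀ ring) g w (Δ^ 1 ℓ (x + 1ℚ)) 1/p ⟩
    (Δ^ 1 ℓ (x + 1ℚ) + 1/p) - (1ℚ + (0ℚ - w - g + 1/p)) + rhs         ≈⟨ +-cong (sub-cong two-ways (≈-refl {1ℚ + (0ℚ - w - g + 1/p)})) (≈-refl {rhs}) ⟩
    (1ℚ + (0ℚ - w - g + 1/p)) - (1ℚ + (0ℚ - w - g + 1/p)) + rhs       ≡⟨ ((∀ a b → a - a + b ≡ b) ∋ solve-∀ ring) (1ℚ + (0ℚ - w - g + 1/p)) rhs ⟩
    rhs                                                               ∎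
    where
    open ≈-Reasoning
    g   = G q x + 1/p
    rhs = 1ℚ - w - Δ^ 1 ℓ (x + 1ℚ)
    P₁  = powℚ (x + 1ℚ) p
    P₂  = powℚ (x + 1ℚ + 1ℚ) p
    g-int = G-q+1/p-integral x-int

    -- Completing both p-th powers to Fermat quotients subtracts x+2 and x+1; their difference 1 is
    -- returned as the summand 1/p.
    φ-value : φ q (λ k → G k x) ≡ Δ^ 1 ℓ (x + 1ℚ) + 1/p
    φ-value = trans (sym (recip-* p (φ q (λ k → G k x)))) (trans (cong (1/p *_) (φ-G q x))
      (((∀ r a b x → r * (b - a) ≡ (b - (x + 1ℚ + 1ℚ)) * r - (a - (x + 1ℚ)) * r + r) ∋ solve-∀ ring) 1/p P₁ P₂ x))

    -- Everything is expressed through the integral g = `G q x` + 1/p. The product p w G equals p w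
    -- g - w, so the pole of G leaves a genuine term -w mod p.
    factorial-term : ℕtoℚ (q !) * G q x ≡ ℕtoℚ p * (w * g) - w - g + 1/p
    factorial-term = trans (cong (_* G q x) q!≡pw-1)
      (trans (((∀ P w G r → (P * w - 1ℚ) * G ≡ P * (w * (G + r)) - w * (P * r) - (G + r) + r) ∋ solve-∀ ring) (ℕtoℚ p) w (G q x) 1/p)
      (cong (λ a → ℕtoℚ p * (w * g) - a - g + 1/p) (trans (cong (w *_) (*-recipℕ p)) (ℚP.*-identityʳ w))))

    two-ways : Δ^ 1 ℓ (x + 1ℚ) + 1/p ≈ 1ℚ + (0ℚ - w - g + 1/p)
    two-ways = begin
      Δ^ 1 ℓ (x + 1ℚ) + 1/p                          ≡⟨ φ-value ⟨
      φ q (λ k → G k x)                              ≈⟨ φ-≈ (λ k → G k x) (λ i i<r → G-integral x-int (s≤s i<r)) ⟩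
      1ℚ + ℕtoℚ (q !) * G q x                        ≡⟨ cong (1ℚ +_) factorial-term ⟩
      1ℚ + (ℕtoℚ p * (w * g) - w - g + 1/p)          ≈⟨ +-cong (≈-refl {1ℚ}) (+-cong (sub-cong (sub-cong (p*≈0 (*-integral w-integral g-int)) (≈-refl {w})) (≈-refl {g})) (≈-refl {1/p})) ⟩
      1ℚ + (0ℚ - w - g + 1/p)                        ∎

  -- By `G-suc` each step down in degree is one more difference in x. The first one removes 1/p and
  -- the constant 1 - w, hence the order k+2 in degree q-1-k.
  G-≈ : ∀ k n {x} → Integral x → suc k ℕ.+ n ≡ q → G n x ≈ - Δ^ (suc (suc k)) ℓ (x + 1ℚ)
  G-≈ zero    n {x} x-int refl = begin
    G n x
      ≡⟨ ((∀ a b r → b ≡ (a + b + r) - (a + r)) ∋ solve-∀ ring) (G q x) (G n x) 1/p ⟩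
    (G q x + G n x + 1/p) - (G q x + 1/p)
      ≡⟨ cong (λ a → a + 1/p - (G q x + 1/p)) (G-suc n x) ⟨
    (G q (x + 1ℚ) + 1/p) - (G q x + 1/p)
      ≈⟨ sub-cong (G-q-≈ (+-integral x-int (ℕ-integral 1))) (G-q-≈ x-int) ⟩
    (1ℚ - w - Δ^ 1 ℓ (x + 1ℚ + 1ℚ)) - (1ℚ - w - Δ^ 1 ℓ (x + 1ℚ))
      ≡⟨ ((∀ w a b → (1ℚ - w - a) - (1ℚ - w - b) ≡ - (a - b)) ∋ solve-∀ ring) w (Δ^ 1 ℓ (x + 1ℚ + 1ℚ)) (Δ^ 1 ℓ (x + 1ℚ)) ⟩
    - Δ^ 2 ℓ (x + 1ℚ) ∎
    where open ≈-Reasoning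
  G-≈ (suc k) n {x} x-int e = begin
    G n x
      ≡⟨ ((∀ a b → b ≡ (a + b) - a) ∋ solve-∀ ring) (G (suc n) x) (G n x) ⟩
    (G (suc n) x + G n x) - G (suc n) x
      ≡⟨ cong (_- G (suc n) x) (G-suc n x) ⟨
    G (suc n) (x + 1ℚ) - G (suc n) x
      ≈⟨ sub-cong (G-≈ k (suc n) (+-integral x-int (ℕ-integral 1)) e′) (G-≈ k (suc n) x-int e′) ⟩
    - Δ^ (suc (suc k)) ℓ (x + 1ℚ + 1ℚ) - - Δ^ (suc (suc k)) ℓ (x + 1ℚ)
      ≡⟨ ((∀ a b → - a - - b ≡ - (a - b)) ∋ solve-∀ ring) (Δ^ (suc (suc k)) ℓ (x + 1ℚ + 1ℚ)) (Δ^ (suc (suc k)) ℓ (x + 1ℚ)) ⟩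
    - Δ^ (suc (suc (suc k))) ℓ (x + 1ℚ) ∎
    where
    open ≈-Reasoning
    e′ : suc k ℕ.+ suc n ≡ q
    e′ = trans (ℕP.+-suc (suc k) n) e

-- Evaluation of the truncated sums mod p

module Evaluation {r : ℕ} (p-prime : Prime (suc (suc r))) (0<r : 0 < r) where
  open Localization p-prime
  open Congruences p-prime 0<r

  ∤-rising : ∀ n k → suc n ℕ.+ k ≤ p → p ∤ rising (suc n) k
  ∤-rising n zero    _ = <⇒∤ (s≤s (s≤s z≤n))
  ∤-rising n (suc k) h = ∤-* (∤-rising n k (ℕP.<⇒≤ n+k<p)) (<⇒∤ n+k<p)
    where
    n+k<p : suc n ℕ.+ k < p
    n+k<p = subst (_≤ p) (ℕP.+-suc (suc n) k) h

  -- The factors n, ..., p-1 are congruent to -k, ..., -1.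
  rising-≈ : ∀ k n → n ℕ.+ k ≡ p → ℕtoℚ (rising n k) ≈ signℚ k * ℕtoℚ (k !)
  rising-≈ zero    n _ = ≈-refl
  rising-≈ (suc k) n e = begin
    ℕtoℚ (rising n (suc k))                                 ≡⟨ trans (cong ℕtoℚ (rising-suc n k)) (ℕtoℚ-* n (rising (suc n) k)) ⟩
    ℕtoℚ n * ℕtoℚ (rising (suc n) k)                        ≈⟨ *-cong (sub-integral (ℕ-integral 0) (ℕ-integral (suc k))) (ℕ-integral (rising (suc n) k)) n≈-k
                                                                 (rising-≈ k (suc n) (trans (sym (ℕP.+-suc n k)) e)) ⟩
    (0ℚ - ℕtoℚ (suc k)) * (signℚ k * ℕtoℚ (k !))            ≡⟨ ((∀ k s f → (0ℚ - k) * (s * f) ≡ - s * (k * f)) ∋ solve-∀ ring) (ℕtoℚ (suc k)) (signℚ k) (ℕtoℚ (k !)) ⟩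
    - signℚ k * (ℕtoℚ (suc k) * ℕtoℚ (k !))                 ≡⟨ cong (- signℚ k *_) (ℕtoℚ-* (suc k) (k !)) ⟨
    - signℚ k * ℕtoℚ (suc k !)                              ∎
    where
    open ≈-Reasoning
    n≈-k : ℕtoℚ n ≈ 0ℚ - ℕtoℚ (suc k)
    n≈-k = begin
      ℕtoℚ n                                     ≡⟨ ((∀ n k → n ≡ n + k - k) ∋ solve-∀ ring) (ℕtoℚ n) (ℕtoℚ (suc k)) ⟩
      ℕtoℚ n + ℕtoℚ (suc k) - ℕtoℚ (suc k)       ≡⟨ cong (_- ℕtoℚ (suc k)) (trans (sym (ℕtoℚ-+ n (suc k))) (cong ℕtoℚ e)) ⟩
      ℕtoℚ p - ℕtoℚ (suc k)                      ≈⟨ sub-cong p≈0 (≈-refl {ℕtoℚ (suc k)}) ⟩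
      0ℚ - ℕtoℚ (suc k)                          ∎

  sign-symmetric : ∀ {a b} → a ℕ.+ b ≡ q → signℚ a ≡ signℚ b
  sign-symmetric {a} {b} e = begin
    signℚ a                          ≡⟨ ℚP.*-identityʳ (signℚ a) ⟨
    signℚ a * 1ℚ                     ≡⟨ cong (signℚ a *_) (sign² b) ⟨
    signℚ a * (signℚ b * signℚ b)    ≡⟨ ℚP.*-assoc (signℚ a) (signℚ b) (signℚ b) ⟨
    signℚ a * signℚ b * signℚ b      ≡⟨ cong (_* signℚ b) (trans (sym (sign-+ a b)) (trans (cong signℚ e) sign-q)) ⟩
    1ℚ * signℚ b                     ≡⟨ ℚP.*-identityˡ (signℚ b) ⟩
    signℚ b                          ∎
    where open ≡-Reasoning

  -- By `rising-≈` the denominator of `β m N` is (-1)^(m+1) (m+1)! mod p, and the signs agree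
  -- because N + m + 1 = q is even. This is the weight of the upper boundary term in `T-suc`.
  sign*β-≈ : ∀ m N → N ℕ.+ suc m ≡ q → signℚ N * β m N ≈ recipℕ (suc m)
  sign*β-≈ m N e = begin
    signℚ N * β m N
      ≡⟨ cong (_* β m N) (sign-symmetric {N} {suc m} e) ⟩
    s * (ℕtoℚ (m !) * recipℕ R)
      ≡⟨ ((∀ s f r → s * (f * r) ≡ 1ℚ * (s * f * r)) ∋ solve-∀ ring) s (ℕtoℚ (m !)) (recipℕ R) ⟩
    1ℚ * (s * ℕtoℚ (m !) * recipℕ R)
      ≡⟨ cong (_* (s * ℕtoℚ (m !) * recipℕ R)) (*-recipℕ (suc m)) ⟨
    ℕtoℚ (suc m) * ρ * (s * ℕtoℚ (m !) * recipℕ R)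
      ≡⟨ ((∀ k ρ s f r → k * ρ * (s * f * r) ≡ ρ * r * (s * (k * f))) ∋ solve-∀ ring) (ℕtoℚ (suc m)) ρ s (ℕtoℚ (m !)) (recipℕ R) ⟩
    ρ * recipℕ R * (s * (ℕtoℚ (suc m) * ℕtoℚ (m !)))
      ≡⟨ cong (λ a → ρ * recipℕ R * (s * a)) (ℕtoℚ-* (suc m) (m !)) ⟨
    ρ * recipℕ R * (s * ℕtoℚ (suc m !))
      ≈⟨ *-congˡ (*-integral ρ-int (recipℕ-integral p∤R)) (rising-≈ (suc m) (suc N) (cong suc e)) ⟨
    ρ * recipℕ R * ℕtoℚ R
      ≡⟨ trans (((∀ ρ r R → ρ * r * R ≡ ρ * (R * r)) ∋ solve-∀ ring) ρ (recipℕ R) (ℕtoℚ R)) (cong (ρ *_) (*-recipℕ R {{∤⇒NonZero p∤R}})) ⟩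
    ρ * 1ℚ
      ≡⟨ ℚP.*-identityʳ ρ ⟩
    ρ ∎
    where
    open ≈-Reasoning
    R = rising (suc N) (suc m)
    ρ = recipℕ (suc m)
    s = signℚ (suc m)
    p∤R : p ∤ R
    p∤R = ∤-rising N (suc m) (ℕP.≤-reflexive (cong suc e))
    ρ-int : Integral ρ
    ρ-int = recipℕ-integral (<⇒∤ (s≤s (ℕP.≤-trans (ℕP.m≤n+m (suc m) N) (ℕP.≤-reflexive e))))

  -- The coefficient of t^q in log(1+t)/t · F_{x+1}, with F_{x+1} = (1+t) F_x.
  binom-expansion : ∀ x → binomℚ (x + 1ℚ) q ≡
    1/p + (logOver r + Σℚ< r (λ i → (logOver (r ∸ i) + logOver (r ∸ suc i)) * G (suc i) x) + 1ℚ * G q x)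
  binom-expansion x = begin
    binomℚ (x + 1ℚ) q
      ≡⟨ log·G (x + 1ℚ) q ⟨
    Σℚ< (suc q) (λ k → logOver k * G (q ∸ k) (x + 1ℚ))
      -- After reversal i is the index of G, as summation by parts expects. The first term, with
      -- logarithm coefficient 1/p and G_0 = 1, is then split off.
      ≡⟨ Σ-reverse (suc q) (λ k → logOver k * G (q ∸ k) (x + 1ℚ)) ⟩
    Σℚ< (suc q) (λ i → logOver (q ∸ i) * G (q ∸ (q ∸ i)) (x + 1ℚ))
      ≡⟨ Σ-first q (λ i → logOver (q ∸ i) * G (q ∸ (q ∸ i)) (x + 1ℚ)) ⟩
    logOver q * G (q ∸ q) (x + 1ℚ) + Σℚ< q (λ i → c i * G (q ∸ (q ∸ suc i)) (x + 1ℚ))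
      ≡⟨ cong₂ _+_ (cong₂ (λ a n → a * 1/p * G n (x + 1ℚ)) sign-q (ℕP.n∸n≡0 q))
           (Σ-cong q (λ i i<q → cong (c i *_) (trans (cong (λ n → G n (x + 1ℚ)) (ℕP.m∸[m∸n]≡n i<q)) (G-suc i x)))) ⟩
    1ℚ * 1/p * 1ℚ + Σℚ< q (λ i → c i * (G (suc i) x + G i x))
      ≡⟨ cong₂ _+_ (((∀ a → 1ℚ * a * 1ℚ ≡ a) ∋ solve-∀ ring) 1/p) (summation-by-parts r c (λ i → G i x)) ⟩
    1/p + (c 0 * 1ℚ + Σℚ< r (λ i → (c i + c (suc i)) * G (suc i) x) + c r * G q x)
      ≡⟨ cong₂ (λ a n → 1/p + (a + Σℚ< r (λ i → (c i + c (suc i)) * G (suc i) x) + logOver n * G q x)) (ℚP.*-identityʳ (c 0)) (ℕP.n∸n≡0 r) ⟩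
    1/p + (c 0 + Σℚ< r (λ i → (c i + c (suc i)) * G (suc i) x) + 1ℚ * G q x) ∎
    where
    open ≡-Reasoning
    c : ℕ → ℚ
    c i = logOver (r ∸ i)

  -- Mod p the coefficient of log(1+t)/t in degree r-i is (-1)^i/(i+1), see `c≈`. Neighbouring ones
  -- add up to (-1)^i/((i+1)(i+2)), the weight of `T 1`, so `binom-expansion` can be solved for
  -- `T 1 r x`.
  T-base : ∀ {x} → Integral x → T 1 r x ≈ binomℚ (x + 1ℚ) q - 1ℚ - (G q x + 1/p)
  T-base {x} x-int = begin
    T 1 r x
      ≡⟨ ((∀ s l g r → s ≡ r + (l + s + 1ℚ * g) - l - (g + r)) ∋ solve-∀ ring) (T 1 r x) 1ℚ (G q x) 1/p ⟩
    1/p + (1ℚ + T 1 r x + 1ℚ * G q x) - 1ℚ - (G q x + 1/p)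
      ≈⟨ sub-cong (sub-cong (+-cong (≈-refl {1/p}) (+-cong (+-cong (c≈ 0 (z≤n)) (Σ-≈-cong r term≈)) (≈-refl {1ℚ * G q x}))) (≈-refl {1ℚ})) (≈-refl {G q x + 1/p}) ⟨
    1/p + (c 0 + Σℚ< r (λ i → (c i + c (suc i)) * G (suc i) x) + 1ℚ * G q x) - 1ℚ - (G q x + 1/p)
      ≡⟨ cong (λ a → a - 1ℚ - (G q x + 1/p)) (binom-expansion x) ⟨
    binomℚ (x + 1ℚ) q - 1ℚ - (G q x + 1/p) ∎
    where
    open ≈-Reasoning
    c : ℕ → ℚ
    c i = logOver (r ∸ i)

    c≈ : ∀ i → i ≤ r → c i ≈ signℚ i * recipℕ (suc i)
    c≈ i i≤r = begin
      signℚ (r ∸ i) * recipℕ (suc (r ∸ i))       ≡⟨ cong (_* recipℕ (suc (r ∸ i))) (sign-symmetric {r ∸ i} {suc i} (trans (ℕP.+-suc (r ∸ i) i) (cong suc (ℕP.m∸n+n≡m i≤r)))) ⟩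
      - signℚ i * recipℕ k                       ≈⟨ *-congˡ (neg-integral (sign-integral i)) reflect ⟩
      - signℚ i * - recipℕ (suc i)               ≡⟨ ((∀ a b → - a * - b ≡ a * b) ∋ solve-∀ ring) (signℚ i) (recipℕ (suc i)) ⟩
      signℚ i * recipℕ (suc i)                   ∎
      where
      k = suc (r ∸ i)
      p∤k : p ∤ k
      p∤k = <⇒∤ (s≤s (s≤s (ℕP.m∸n≤m r i)))
      p∤1+i : p ∤ suc i
      p∤1+i = <⇒∤ (s≤s (s≤s i≤r))
      k+1+i≡p : k ℕ.+ suc i ≡ p
      k+1+i≡p = trans (ℕP.+-suc k i) (cong (suc ∘ suc) (ℕP.m∸n+n≡m i≤r))
      -- 1/k + 1/(i+1) = p/(k (i+1)), as k + (i+1) = p.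
      reflect : recipℕ k ≈ - recipℕ (suc i)
      reflect = begin
        recipℕ k
          ≡⟨ ((∀ a b → a ≡ 1ℚ * a + 1ℚ * b - b) ∋ solve-∀ ring) (recipℕ k) (recipℕ (suc i)) ⟩
        1ℚ * recipℕ k + 1ℚ * recipℕ (suc i) - recipℕ (suc i)
          ≡⟨ cong₂ (λ a b → a * recipℕ k + b * recipℕ (suc i) - recipℕ (suc i)) (*-recipℕ (suc i)) (*-recipℕ k) ⟨
        ℕtoℚ (suc i) * recipℕ (suc i) * recipℕ k + ℕtoℚ k * recipℕ k * recipℕ (suc i) - recipℕ (suc i)
          ≡⟨ ((∀ n a k b → n * a * b + k * b * a - a ≡ (k + n) * (b * a) - a) ∋ solve-∀ ring) (ℕtoℚ (suc i)) (recipℕ (suc i)) (ℕtoℚ k) (recipℕ k) ⟩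
        (ℕtoℚ k + ℕtoℚ (suc i)) * (recipℕ k * recipℕ (suc i)) - recipℕ (suc i)
          ≡⟨ cong (λ a → a * (recipℕ k * recipℕ (suc i)) - recipℕ (suc i)) (trans (sym (ℕtoℚ-+ k (suc i))) (cong ℕtoℚ k+1+i≡p)) ⟩
        ℕtoℚ p * (recipℕ k * recipℕ (suc i)) - recipℕ (suc i)
          ≈⟨ sub-cong (p*≈0 (*-integral (recipℕ-integral p∤k) (recipℕ-integral p∤1+i))) (≈-refl {recipℕ (suc i)}) ⟩
        0ℚ - recipℕ (suc i)
          ≡⟨ ℚP.+-identityˡ (- recipℕ (suc i)) ⟩
        - recipℕ (suc i) ∎

    term≈ : ∀ i → i < r → (c i + c (suc i)) * G (suc i) x ≈ signℚ i * β 1 i * G (suc i) x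
    term≈ i i<r = *-congʳ (G-integral x-int (s≤s i<r)) (begin
      c i + c (suc i)                                             ≈⟨ +-cong (c≈ i (ℕP.<⇒≤ i<r)) (c≈ (suc i) i<r) ⟩
      signℚ i * recipℕ (suc i) + - signℚ i * recipℕ (2 ℕ.+ i)     ≡⟨ ((∀ s a b → s * a + - s * b ≡ s * (a - b)) ∋ solve-∀ ring) (signℚ i) (recipℕ (suc i)) (recipℕ (2 ℕ.+ i)) ⟩
      signℚ i * (recipℕ (suc i) - recipℕ (2 ℕ.+ i))               ≡⟨ cong₂ (λ a b → signℚ i * (a - b)) (β-zeroˡ i) (β-zeroˡ (suc i)) ⟨
      signℚ i * (β 0 i - β 0 (suc i))                             ≡⟨ cong (signℚ i *_) (β-suc 0 i) ⟨
      signℚ i * β 1 i                                             ∎)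

  -- `T-suc` solved for the sum of higher order. That order is at least 2, which puts the boundary
  -- term `G (suc N) x` in degree below q, where it is integral and `G-≈` applies.
  T-step : ∀ m N {x} → Integral x → N ℕ.+ suc (suc m) ≡ q →
           T (suc (suc m)) N x ≈ T (suc m) (suc N) (x + 1ℚ) - recipℕ (2 ℕ.+ m) + recipℕ (2 ℕ.+ m) * Δ^ (suc (suc m)) ℓ (x + 1ℚ)
  T-step m N {x} x-int e = begin
    T (suc (suc m)) N x
      ≡⟨ ((∀ ρ t g → t ≡ (ρ + t + g) - ρ - g) ∋ solve-∀ ring) ρ (T (suc (suc m)) N x) (cN * g) ⟩
    (ρ + T (suc (suc m)) N x + cN * g) - ρ - cN * g
      ≡⟨ cong (λ a → a - ρ - cN * g) (T-suc (suc m) N x) ⟨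
    T (suc m) (suc N) (x + 1ℚ) - ρ - cN * g
      ≈⟨ sub-cong (≈-refl {T (suc m) (suc N) (x + 1ℚ) - ρ}) (*-cong (recipℕ-integral (<⇒∤ 2+m<p)) (G-integral x-int N<r) (sign*β-≈ (suc m) N e) (G-≈ m (suc N) x-int e′)) ⟩
    T (suc m) (suc N) (x + 1ℚ) - ρ - ρ * - Δ^ (suc (suc m)) ℓ (x + 1ℚ)
      ≡⟨ ((∀ t ρ d → t - ρ - ρ * - d ≡ t - ρ + ρ * d) ∋ solve-∀ ring) (T (suc m) (suc N) (x + 1ℚ)) ρ (Δ^ (suc (suc m)) ℓ (x + 1ℚ)) ⟩
    T (suc m) (suc N) (x + 1ℚ) - ρ + ρ * Δ^ (suc (suc m)) ℓ (x + 1ℚ) ∎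
    where
    open ≈-Reasoning
    ρ = recipℕ (2 ℕ.+ m)
    g = G (suc N) x
    cN = signℚ N * β (suc m) N
    e′ : suc m ℕ.+ suc N ≡ q
    e′ = trans (ℕP.+-comm (suc m) (suc N)) (trans (sym (ℕP.+-suc N (suc m))) e)
    2+m<p : 2 ℕ.+ m < p
    2+m<p = s≤s (ℕP.≤-trans (ℕP.m≤n+m (2 ℕ.+ m) N) (ℕP.≤-reflexive e))
    N<r : suc N < q
    N<r = ℕP.≤-trans (s≤s (ℕP.m≤n+m (suc N) m)) (ℕP.≤-reflexive e′)

  -- The right-hand side of the theorem minus H_m - ℓ(x+m+1), the explicit summands of γ^K, with
  -- binom(x+m, q) in place of δ. The binomial coefficient is what `T-base` produces; it depends on
  -- x+m alone, so the recursion in m leaves it unchanged.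
  R : ℕ → ℚ → ℚ
  R m x = binomℚ (x + ℕtoℚ m) q + w - 1ℚ - H m + H m * ℓ (x + ℕtoℚ (suc m)) + A m ℓ (x + 1ℚ)

  -- The summand ρ L contributed by the new term of H_{m+1} cancels the last term in `A-suc`; what
  -- remains is the recursion of `T-step`.
  R-suc : ∀ m x → R (suc m) x ≡ R m (x + 1ℚ) - recipℕ (suc m) + recipℕ (suc m) * Δ^ (suc m) ℓ (x + 1ℚ)
  R-suc m x = begin
    B′ + w - 1ℚ - H (suc m) + H (suc m) * L + A (suc m) ℓ (x + 1ℚ)
      ≡⟨ cong₂ (λ h a → B′ + w - 1ℚ - h + h * L + a) (Σ-last m (λ j → recipℕ (suc j))) (A-suc m ℓ (x + 1ℚ)) ⟩
    B′ + w - 1ℚ - (H m + ρ) + (H m + ρ) * L + (A m ℓ (x + 1ℚ + 1ℚ) + ρ * (D - ℓ (x + 1ℚ + ℕtoℚ (suc m))))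
      ≡⟨ cong (λ z → B′ + w - 1ℚ - (H m + ρ) + (H m + ρ) * L + (A m ℓ (x + 1ℚ + 1ℚ) + ρ * (D - ℓ z))) (+-ℕtoℚ-suc x (suc m)) ⟩
    B′ + w - 1ℚ - (H m + ρ) + (H m + ρ) * L + (A m ℓ (x + 1ℚ + 1ℚ) + ρ * (D - L))
      ≡⟨ ((∀ b w h ρ l a d → b + w - 1ℚ - (h + ρ) + (h + ρ) * l + (a + ρ * (d - l)) ≡ b + w - 1ℚ - h + h * l + a - ρ + ρ * d) ∋ solve-∀ ring)
           B′ w (H m) ρ L (A m ℓ (x + 1ℚ + 1ℚ)) D ⟩
    B′ + w - 1ℚ - H m + H m * L + A m ℓ (x + 1ℚ + 1ℚ) - ρ + ρ * D
      ≡⟨ cong₂ (λ y z → binomℚ y q + w - 1ℚ - H m + H m * ℓ z + A m ℓ (x + 1ℚ + 1ℚ) - ρ + ρ * D) (+-ℕtoℚ-suc x m) (+-ℕtoℚ-suc x (suc m)) ⟨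
    R m (x + 1ℚ) - ρ + ρ * D ∎
    where
    open ≡-Reasoning
    B′ = binomℚ (x + ℕtoℚ (suc m)) q
    ρ = recipℕ (suc m)
    L = ℓ (x + ℕtoℚ (suc (suc m)))
    D = Δ^ (suc m) ℓ (x + 1ℚ)

  -- Induction on m with x free: lowering m raises both N and x by one, which preserves N + m + 1 =
  -- q.
  T-≈ : ∀ m N {x} → Integral x → N ℕ.+ suc m ≡ q → T (suc m) N x ≈ R (suc m) x
  T-≈ zero N {x} x-int e with ℕP.suc-injective (trans (sym (ℕP.+-comm N 1)) e)
  ... | refl = begin
    T 1 r x
      ≈⟨ T-base x-int ⟩
    B - 1ℚ - (G q x + 1/p)
      ≈⟨ sub-cong (≈-refl {B - 1ℚ}) (G-q-≈ x-int) ⟩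
    B - 1ℚ - (1ℚ - w - (ℓ (x + 1ℚ + 1ℚ) - ℓ (x + 1ℚ)))
      ≡⟨ cong₂ (λ y z → B - 1ℚ - (1ℚ - w - (ℓ y - ℓ z))) (+-ℕtoℚ-suc x 1) (sym (ℚP.+-identityʳ (x + 1ℚ))) ⟩
    B - 1ℚ - (1ℚ - w - (ℓ (x + ℕtoℚ 2) - ℓ (x + 1ℚ + 0ℚ)))
      -- Here H_1 = 1, and `A 1 ℓ (x + 1ℚ)` unfolds to the single term -ℓ(x+1).
      ≡⟨ ((∀ b w l₂ l₁ → b - 1ℚ - (1ℚ - w - (l₂ - l₁)) ≡ b + w - 1ℚ - 1ℚ + 1ℚ * l₂ + (- 1ℚ * 1ℚ * 1ℚ * l₁ + 0ℚ)) ∋ solve-∀ ring) B w (ℓ (x + ℕtoℚ 2)) (ℓ (x + 1ℚ + 0ℚ)) ⟩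
    R 1 x ∎
    where
    open ≈-Reasoning
    B = binomℚ (x + 1ℚ) q
  T-≈ (suc m) N {x} x-int e = begin
    T (suc (suc m)) N x
      ≈⟨ T-step m N x-int e ⟩
    T (suc m) (suc N) (x + 1ℚ) - ρ + ρ * D
      ≈⟨ +-cong (sub-cong (T-≈ m (suc N) (+-integral x-int (ℕ-integral 1)) (trans (sym (ℕP.+-suc N (suc m))) e)) (≈-refl {ρ})) (≈-refl {ρ * D}) ⟩
    R (suc m) (x + 1ℚ) - ρ + ρ * D
      ≡⟨ R-suc (suc m) x ⟨
    R (suc (suc m)) x ∎
    where
    open ≈-Reasoning
    ρ = recipℕ (2 ℕ.+ m)
    D = Δ^ (suc (suc m)) ℓ (x + 1ℚ)

  -- For z = n/d, Fermat gives n z^q = d z^p ≡ d z = n, and n is a unit. Since `cancel-≈` cancels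
  -- natural numbers, the sign of n is treated separately.
  unit-power : ∀ {z} → Integral z → p ∤ ℤ.∣ ↥ z ∣ → powℚ z q ≈ 1ℚ
  unit-power {z} z-int p∤n with ↥ z | ↥≡*↧ z
  ... | n | zd≡n = cancel-≈ p∤n (scale n zd≡n)
    where
    open ≈-Reasoning
    d = ℚ.denominatorℕ z
    nzq≈n : ∀ n → z * ℕtoℚ d ≡ ℤtoℚ n → ℤtoℚ n * powℚ z q ≈ ℤtoℚ n
    nzq≈n n e = begin
      ℤtoℚ n * powℚ z q           ≡⟨ cong (_* powℚ z q) e ⟨
      z * ℕtoℚ d * powℚ z q       ≡⟨ ((∀ z d y → z * d * y ≡ d * (z * y)) ∋ solve-∀ ring) z (ℕtoℚ d) (powℚ z q) ⟩
      ℕtoℚ d * powℚ z p           ≈⟨ *-congˡ (ℕ-integral d) (fermat z-int) ⟩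
      ℕtoℚ d * z                  ≡⟨ trans (ℚP.*-comm (ℕtoℚ d) z) e ⟩
      ℤtoℚ n                      ∎
    scale : ∀ n → z * ℕtoℚ d ≡ ℤtoℚ n → ℕtoℚ ℤ.∣ n ∣ * powℚ z q ≈ ℕtoℚ ℤ.∣ n ∣ * 1ℚ
    scale (ℤ.+ n) e = ≈-trans (nzq≈n (ℤ.+ n) e) (≡⇒≈ (sym (ℚP.*-identityʳ (ℕtoℚ n))))
    scale ℤ.-[1+ n ] e = begin
      ℕtoℚ (suc n) * powℚ z q             ≡⟨ ((∀ a b → a * b ≡ - (- a * b)) ∋ solve-∀ ring) (ℕtoℚ (suc n)) (powℚ z q) ⟩
      - (- ℕtoℚ (suc n) * powℚ z q)       ≡⟨ cong (λ a → - (a * powℚ z q)) (ℤtoℚ-neg (ℤ.+ suc n)) ⟨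
      - (ℤtoℚ ℤ.-[1+ n ] * powℚ z q)      ≈⟨ neg-cong (nzq≈n ℤ.-[1+ n ] e) ⟩
      - ℤtoℚ ℤ.-[1+ n ]                   ≡⟨ cong -_ (ℤtoℚ-neg (ℤ.+ suc n)) ⟩
      - (- ℕtoℚ (suc n))                  ≡⟨ ((∀ a → - (- a) ≡ a * 1ℚ) ∋ solve-∀ ring) (ℕtoℚ (suc n)) ⟩
      ℕtoℚ (suc n) * 1ℚ                   ∎

  -- `binom-≈` solved for the binomial coefficient, with q! ≡ -1.
  binom-power : ∀ {y} → Integral y → binomℚ y q ≈ 1ℚ - powℚ (y + 1ℚ) q
  binom-power {y} y-int = begin
    B                                                     ≡⟨ ((∀ b P w → b ≡ 1ℚ - (1ℚ + (P * w - 1ℚ) * b) + P * (w * b)) ∋ solve-∀ ring) B (ℕtoℚ p) w ⟩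
    1ℚ - (1ℚ + (ℕtoℚ p * w - 1ℚ) * B) + ℕtoℚ p * (w * B)   ≡⟨ cong (λ a → 1ℚ - (1ℚ + a * B) + ℕtoℚ p * (w * B)) q!≡pw-1 ⟨
    1ℚ - (1ℚ + ℕtoℚ (q !) * B) + ℕtoℚ p * (w * B)          ≈⟨ +-cong (sub-cong (≈-refl {1ℚ}) (≈-sym (binom-≈ y-int))) (p*≈0 (*-integral w-integral (binom-integral y-int (ℕP.n<1+n q)))) ⟩
    1ℚ - powℚ (y + 1ℚ) q + 0ℚ                              ≡⟨ ℚP.+-identityʳ (1ℚ - powℚ (y + 1ℚ) q) ⟩
    1ℚ - powℚ (y + 1ℚ) q                                   ∎
    where
    open ≈-Reasoning
    B = binomℚ y q

  -- A nonzero numerator of y+1 below p is prime to p, so (y+1)^q is 1 mod p; for y = -1 the power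
  -- is 0^q = 0, as q is positive. The bound on the numerator is what restricts the theorem to large
  -- p in terms of x + m.
  binom-δ : ∀ {y} → Integral y → ℤ.∣ ↥ (y + 1ℚ) ∣ < p → binomℚ y q ≈ δ₋₁ y
  binom-δ {y} y-int n<p with y ≟ - 1ℚ
  ... | yes refl = ≈-trans (binom-power y-int) (≡⇒≈ (cong (λ a → 1ℚ - a) (ℚP.*-zeroˡ (powℚ 0ℚ r))))
  ... | no y≢-1  = ≈-trans (binom-power y-int)
    (sub-cong (≈-refl {1ℚ}) (unit-power (+-integral y-int (ℕ-integral 1)) (<⇒∤ {{n≢0}} n<p)))
    where
    n≢0 : NonZero ℤ.∣ ↥ (y + 1ℚ) ∣
    n≢0 = ℕ.≢-nonZero (λ n≡0 → y≢-1 (trans (((∀ y → y ≡ y + 1ℚ - 1ℚ) ∋ solve-∀ ring) y)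
      (cong (_- 1ℚ) (ℚP.↥p≡0⇒p≡0 (y + 1ℚ) (ℤP.∣i∣≡0⇒i≡0 n≡0)))))

  -- From congruences between rationals to residues in 𝒜

  infix 4 _represents_
  _represents_ : ℤ → ℚ → Set
  a represents u = ℤtoℚ a ≈ u

  +-represents : ∀ {a b u v} → a represents u → b represents v → a ℤ.+ b represents u + v
  +-represents {a} {b} a≈u b≈v = ≈-trans (≡⇒≈ (ℤtoℚ-+ a b)) (+-cong a≈u b≈v)

  sub-represents : ∀ {a b u v} → a represents u → b represents v → a ℤ.- b represents u - v
  sub-represents {a} {b} a≈u b≈v = +-represents {a} {ℤ.- b} a≈u (≈-trans (≡⇒≈ (ℤtoℚ-neg b)) (neg-cong b≈v))

  *-represents : ∀ {a b u v} → Integral u → a represents u → b represents v → a ℤ.* b represents u * v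
  *-represents {a} {b} u-int a≈u b≈v = ≈-trans (≡⇒≈ (ℤtoℚ-* a b)) (*-cong u-int (ℤ-integral b) a≈u b≈v)

  Σ-represents : ∀ n (F : ℕ → 𝒜) (f : ℕ → ℚ) → (∀ i → i < n → F i p represents f i) → Σ𝒜< n F p represents Σℚ< n f
  Σ-represents zero    F f h = ≈-refl
  Σ-represents (suc n) F f h = subst₂ (λ X u → foldr _+𝒜_ 0𝒜 (F 0 ∷ X) p represents u)
    (sym (trans (map-applyUpTo suc F n) (sym (map-upTo (F ∘ suc) n)))) (sym (Σ-first n f))
    (+-represents {F 0 p} {Σ𝒜< n (F ∘ suc) p} (h 0 (s≤s z≤n)) (Σ-represents n (F ∘ suc) (f ∘ suc) (λ i i<n → h (suc i) (s≤s i<n))))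

  H-integral : ∀ m → m ≤ q → Integral (H m)
  H-integral m m≤q = Σ-integral m (λ j → recipℕ (suc j)) (λ j j<m → recipℕ-integral (<⇒∤ (s≤s (ℕP.≤-trans j<m m≤q))))

  c-integral : ∀ m j → j < m → m ≤ q → Integral (signℚ (m ∸ j) * ℕtoℚ (m C j) * recipℕ (m ∸ j))
  c-integral m j j<m m≤q = *-integral (*-integral (sign-integral (m ∸ j)) (ℕ-integral (m C j)))
    (recipℕ-integral (<⇒∤ {{ℕ.>-nonZero (ℕP.m<n⇒0<n∸m j<m)}} (s≤s (ℕP.≤-trans (ℕP.m∸n≤m m j) m≤q))))

  A-integral : ∀ m {y} → m ≤ q → Integral y → Integral (A m ℓ y)
  A-integral m {y} m≤q y-int = Σ-integral m (λ j → signℚ (m ∸ j) * ℕtoℚ (m C j) * recipℕ (m ∸ j) * ℓ (y + ℕtoℚ j))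
    (λ j j<m → *-integral (c-integral m j j<m m≤q) (ℓ-integral (+-integral y-int (ℕ-integral j))))

  R-integral : ∀ m {x} → Integral x → suc m ≤ q → Integral (R (suc m) x)
  R-integral m x-int 1+m≤q = +-integral
    (+-integral (sub-integral (sub-integral (+-integral (binom-integral (+-integral x-int (ℕ-integral (suc m))) (ℕP.n<1+n q)) w-integral) (ℕ-integral 1)) H-int)
      (*-integral H-int (ℓ-integral (+-integral x-int (ℕ-integral (2 ℕ.+ m))))))
    (A-integral (suc m) 1+m≤q (+-integral x-int (ℕ-integral 1)))
    where H-int = H-integral (suc m) 1+m≤q

  -- `redℚ` is meaningful only on a p-integral argument; for the sum T′ this is inherited from `R`
  -- through the congruence already proved. The number of terms `N` satisfies N + m + 1 = q, as
  -- `T-≈` requires.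
  γK-represents : ∀ m x → Integral x → suc m ≤ q → γK (suc m) x p represents
                  R (suc m) x + H (suc m) - ℓ (x + ℕtoℚ (2 ℕ.+ m))
  γK-represents m x x-int 1+m≤q = sub-represents
    {redℚ p T′ ℤ.+ redℚ p (H (suc m))} {redℚ p (ℓ (x + ℕtoℚ (2 ℕ.+ m)))}
    (+-represents {redℚ p T′} {redℚ p (H (suc m))}
      (≈-trans (redℚ-≈ (≈-integral T′≈R (R-integral m x-int 1+m≤q))) T′≈R) (redℚ-≈ (H-integral (suc m) 1+m≤q)))
    (redℚ-≈ (ℓ-integral (+-integral x-int (ℕ-integral (2 ℕ.+ m)))))
    where
    N = p ∸ suc m ∸ 1
    T′ = ℕtoℚ (suc m !) * Σℚ< N (λ i → signℚ i * G (suc i) x * recipℕ (rising (suc i) (suc (suc m))))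
    T′≡T : T′ ≡ T (suc m) N x
    T′≡T = trans (sym (Σ-*ˡ N (ℕtoℚ (suc m !)) (λ i → signℚ i * G (suc i) x * recipℕ (rising (suc i) (suc (suc m))))))
      (Σ-cong N (λ i _ → ((∀ f s g r → f * (s * g * r) ≡ s * (f * r) * g) ∋ solve-∀ ring)
        (ℕtoℚ (suc m !)) (signℚ i) (G (suc i) x) (recipℕ (rising (suc i) (suc (suc m))))))
    N+1+m≡q : N ℕ.+ suc m ≡ q
    N+1+m≡q = trans (cong (ℕ._+ suc m) (trans (ℕP.∸-+-assoc q m 1) (cong (q ∸_) (ℕP.+-comm m 1)))) (ℕP.m∸n+n≡m 1+m≤q)
    T′≈R : T′ ≈ R (suc m) x
    T′≈R = ≈-trans (≡⇒≈ T′≡T) (T-≈ m N x-int N+1+m≡q)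

  congruence-mod-p : ∀ m x → ℚ.denominatorℕ x < p → ℤ.∣ ↥ (x + ℕtoℚ (suc m) + 1ℚ) ∣ < p → suc m ≤ q →
    (ℤ.+ p) ℤD.∣ (γK (suc m) x p ℤ.-
      (γW +𝒜 ι (δ₋₁ (x + ℕtoℚ (suc m))) -𝒜 ι 1ℚ
        +𝒜 ι (H (suc m) - 1ℚ) *𝒜 ℓ𝒜 (x + ℕtoℚ (suc (suc m)))
        +𝒜 Σ𝒜< (suc m) (λ j → ι (signℚ (suc m ∸ j) * ℕtoℚ (suc m C j) * recipℕ (suc m ∸ j))
                           *𝒜 ℓ𝒜 (x + ℕtoℚ (suc j)))) p)
  congruence-mod-p m x d<p n<p 1+m≤q = ≈⇒∣ (γK (suc m) x p) (e₄ ℤ.+ e₅) (begin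
    ℤtoℚ (γK (suc m) x p)
      ≈⟨ γK-represents m x x-int 1+m≤q ⟩
    R (suc m) x + h - L
      -- Adding H - ℓ back to `R` restores the right-hand side of the theorem, up to the binomial
      -- coefficient in place of δ.
      ≡⟨ ((∀ b w h l a → b + w - 1ℚ - h + h * l + a + h - l ≡ w + b - 1ℚ + (h - 1ℚ) * l + a) ∋ solve-∀ ring) (binomℚ y q) w h L (A (suc m) ℓ (x + 1ℚ)) ⟩
    w + binomℚ y q - 1ℚ + (h - 1ℚ) * L + A (suc m) ℓ (x + 1ℚ)
      ≈⟨ +-cong (+-cong (sub-cong (+-cong (≈-refl {w}) B≈δ) (≈-refl {1ℚ})) (≈-refl {(h - 1ℚ) * L})) (≡⇒≈ (Σ-cong (suc m) (λ j _ → cong (λ z → c j * ℓ z) (+-ℕtoℚ-suc x j)))) ⟩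
    w + δ₋₁ y - 1ℚ + (h - 1ℚ) * L + Σℚ< (suc m) (λ j → c j * ℓ (x + ℕtoℚ (suc j)))
      ≈⟨ +-represents {e₄} {e₅}
           (+-represents {e₃} {e₂}
             (sub-represents {γW p ℤ.+ ι (δ₋₁ y) p} {ι 1ℚ p}
               (+-represents {γW p} {ι (δ₋₁ y) p} (redℚ-≈ w-integral) (redℚ-≈ (≈-integral (≈-sym B≈δ) (binom-integral y-int (ℕP.n<1+n q)))))
               (redℚ-≈ (ℕ-integral 1)))
             (*-represents {ι (h - 1ℚ) p} {ℓ𝒜 (x + ℕtoℚ (2 ℕ.+ m)) p} h-1-int (redℚ-≈ h-1-int) (redℚ-≈ (ℓ-integral (+-integral x-int (ℕ-integral (2 ℕ.+ m)))))))
           (Σ-represents (suc m) F (λ j → c j * ℓ (x + ℕtoℚ (suc j))) (λ j j<1+m →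
             *-represents {ι (c j) p} {ℓ𝒜 (x + ℕtoℚ (suc j)) p} (c-integral (suc m) j j<1+m 1+m≤q) (redℚ-≈ (c-integral (suc m) j j<1+m 1+m≤q))
               (redℚ-≈ (ℓ-integral (+-integral x-int (ℕ-integral (suc j))))))) ⟨
    ℤtoℚ (e₄ ℤ.+ e₅) ∎)
    where
    open ≈-Reasoning
    y = x + ℕtoℚ (suc m)
    h = H (suc m)
    L = ℓ (x + ℕtoℚ (2 ℕ.+ m))
    c : ℕ → ℚ
    c j = signℚ (suc m ∸ j) * ℕtoℚ (suc m C j) * recipℕ (suc m ∸ j)
    F : ℕ → 𝒜
    F j = ι (c j) *𝒜 ℓ𝒜 (x + ℕtoℚ (suc j))
    e₂ e₃ e₄ e₅ : ℤ
    e₂ = ι (h - 1ℚ) p ℤ.* ℓ𝒜 (x + ℕtoℚ (2 ℕ.+ m)) p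
    e₃ = γW p ℤ.+ ι (δ₋₁ y) p ℤ.- ι 1ℚ p
    e₄ = e₃ ℤ.+ e₂
    e₅ = Σ𝒜< (suc m) F p
    x-int = small-denominator⇒integral x d<p
    y-int = +-integral x-int (ℕ-integral (suc m))
    h-1-int = sub-integral (H-integral (suc m) 1+m≤q) (ℕ-integral 1)
    B≈δ : binomℚ y q ≈ δ₋₁ y
    B≈δ = binom-δ y-int n<p

theorem3p9 : (m : ℕ) → 1 ≤ m → (x : ℚ) →
    γK m x ≈𝒜
    γW +𝒜 ι (δ₋₁ (x + ℕtoℚ m)) -𝒜 ι 1ℚ
    +𝒜 ι (H m - 1ℚ) *𝒜 ℓ𝒜 (x + ℕtoℚ (suc m))
    +𝒜 Σ𝒜< m (λ j → ι (signℚ (m ∸ j) * ℕtoℚ (m C j) * recipℕ (m ∸ j))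
    *𝒜 ℓ𝒜 (x + ℕtoℚ (suc j)))
-- A prime above this bound exceeds each of the three summands: `a` makes x p-integral, `b` controls
-- the numerator in `binom-δ`, and 2 + m makes p odd and keeps the denominators of H and of the sum
-- over j prime to p.
theorem3p9 (suc m) _ x = a ℕ.+ (b ℕ.+ (2 ℕ.+ m)) , holds
  where
  a = ℚ.denominatorℕ x
  b = ℤ.∣ ↥ (x + ℕtoℚ (suc m) + 1ℚ) ∣
  holds : ∀ p → Prime p → a ℕ.+ (b ℕ.+ (2 ℕ.+ m)) < p → _
  holds p p-prime N<p with ℕP.≤-<-trans (ℕP.≤-trans (ℕP.m≤n+m (2 ℕ.+ m) b) (ℕP.m≤n+m (b ℕ.+ (2 ℕ.+ m)) a)) N<p
  holds (suc (suc r)) p-prime N<p | s≤s (s≤s m<r) = Evaluation.congruence-mod-p p-prime (ℕP.≤-<-trans z≤n m<r) m x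
    (ℕP.≤-<-trans (ℕP.m≤m+n a (b ℕ.+ (2 ℕ.+ m))) N<p)
    (ℕP.≤-<-trans (ℕP.≤-trans (ℕP.m≤m+n b (2 ℕ.+ m)) (ℕP.m≤n+m (b ℕ.+ (2 ℕ.+ m)) a)) N<p)
    (s≤s (ℕP.<⇒≤ m<r))
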